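{- For every homogeneous polynomial $f(\mathbf{x}) \in \mathbb{C}[x_1,\ldots,x_n]$, we have $\mathrm{commRO}(f) \leq \mathrm{DPD}(f)$.
   Context: For $f \in \mathbb{C}[x_1,\ldots,x_n]$, the dimension of partial derivatives is $\mathrm{DPD}(f) := \dim_{\mathbb{C}} \mathrm{span}_{\mathbb{C}}\{\partial_{\mathbf{e}} f : \mathbf{e} \in \mathbb{N}^n\}$, where $\partial_{\mathbf{e}} f$ is the partial derivative of $f$ with respect to the monomial $x_1^{e_1}\cdots x_n^{e_n}$ (so $\mathbf{e}=\mathbf{0}$ gives $f$ itself). A read-once oblivious ABP (ROABP) of width $w$ computing an $n$-variate polynomial $f$ of individual degree at most $d$ consists of a permutation $\sigma$ of $[n]$, matrices $A_{j,k} \in \mathbb{C}^{w\times w}$ for $j\in[n]$, $0\le k\le d$, and vectors $\mathbf{u},\mathbf{v}\in\mathbb{C}^w$ such that $f(\mathbf{x}) = \mathbf{u}^{T} M_{\sigma(1)}(x_{\sigma(1)}) \cdots M_{\sigma(n)}(x_{\sigma(n)}) \mathbf{v}$, where $M_j(x_j) = \sum_{k=0}^{d} A_{j,k} x_j^k$. The $A_{j,k}$ are its coefficient matrices. A commutative ROABP is an ROABP whose coefficient matrices all pairwise commute. $\mathrm{commRO}(f)$ denotes the smallest $w$ such that some width-$w$ commutative ROABP computes $f$. -}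

module Defs where

open import Algebra.Bundles using (CommutativeRing; RawSemiring; Semiring)
open import Algebra.Structures using (IsCommutativeRing)
import Algebra.Definitions.RawSemiring as RawSemiringDefinitions
open import Data.Bool.Base using (if_then_else_)
open import Data.Fin.Base using (Fin; toℕ)
open import Data.Fin.Permutation using (Permutation′; _⟨$⟩ʳ_)
open import Data.Fin.Properties as Fin using ()
open import Data.List.Base as List using (List; []; _∷_; _++_)
open import Data.Nat.Base as ℕ using (ℕ; suc; _⊔_)
import Data.Nat.GeneralisedArithmetic as ℕ
import Data.Nat.Properties as ℕ
open import Data.Product.Base using (Σ-syntax; ∃-syntax; _×_; _,_; proj₁; proj₂)
open import Data.Rational.Base as ℚ using (ℚ; 0ℚ; 1ℚ; ½; ∣_∣)
import Data.Rational.Properties as ℚ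
open import Data.Rational.Solver using (module +-*-Solver)
open import Data.Vec.Base as Vec using (Vec)
import Data.Vec.Properties as Vec
open import Data.Vec.Functional as Vector using (Vector)
open import Function.Base using (_∘_)
open import Level using (0ℓ)
open import Relation.Binary.PropositionalEquality
  using (_≡_; _≢_; refl; sym; trans; cong; cong₂; subst)
open import Relation.Binary.Structures using (IsEquivalence)
open import Relation.Nullary.Decidable using (does)
open import Relation.Unary using (Pred)

private
  variable
    B ε : ℚ

-- ∃ is Σ, so a real number carries a modulus of convergence; _≈ℝ_ ignores it.
IsCauchy : (ℕ → ℚ) → Set
IsCauchy s = ∀ ε → 0ℚ ℚ.< ε →
             ∃[ N ] (∀ m n → N ℕ.≤ m → N ℕ.≤ n → ∣ s m ℚ.- s n ∣ ℚ.< ε)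

record ℝ : Set where
  constructor mkℝ
  field
    seq    : ℕ → ℚ
    cauchy : IsCauchy seq

open ℝ

infix 4 _≈ℝ_
_≈ℝ_ : ℝ → ℝ → Set
x ≈ℝ y = ∀ ε → 0ℚ ℚ.< ε →
         ∃[ N ] (∀ n → N ℕ.≤ n → ∣ seq x n ℚ.- seq y n ∣ ℚ.< ε)

abstract
  half-pos : 0ℚ ℚ.< ε → 0ℚ ℚ.< ½ ℚ.* ε
  half-pos {ε} 0<ε =
    ℚ.positive⁻¹ (½ ℚ.* ε) {{ℚ.pos*pos⇒pos ½ ε {{ℚ.positive 0<ε}}}}

  half+half : ∀ ε → ½ ℚ.* ε ℚ.+ ½ ℚ.* ε ≡ ε
  half+half ε = trans (sym (ℚ.*-distribʳ-+ ε ½ ½)) (ℚ.*-identityˡ ε)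

  diff-self : ∀ a → ∣ a ℚ.- a ∣ ≡ 0ℚ
  diff-self a = cong ∣_∣ (ℚ.+-inverseʳ a)

  diff-sym : ∀ a b → ∣ a ℚ.- b ∣ ≡ ∣ b ℚ.- a ∣
  diff-sym a b = trans (sym (ℚ.∣-p∣≡∣p∣ (a ℚ.- b))) (cong ∣_∣
    (solve 2 (λ a b → :- (a :- b) := b :- a) refl a b))
    where open +-*-Solver

  diff-trans : ∀ a b c → ∣ a ℚ.- b ∣ ℚ.< ½ ℚ.* ε → ∣ b ℚ.- c ∣ ℚ.< ½ ℚ.* ε →
               ∣ a ℚ.- c ∣ ℚ.< ε
  diff-trans {ε} a b c p q = begin-strict
    ∣ a ℚ.- c ∣                     ≡⟨ cong ∣_∣ (solve 3 (λ a b c →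
                                         a :- c := (a :- b) :+ (b :- c)) refl a b c) ⟩
    ∣ (a ℚ.- b) ℚ.+ (b ℚ.- c) ∣     ≤⟨ ℚ.∣p+q∣≤∣p∣+∣q∣ (a ℚ.- b) (b ℚ.- c) ⟩
    ∣ a ℚ.- b ∣ ℚ.+ ∣ b ℚ.- c ∣     <⟨ ℚ.+-mono-< p q ⟩
    ½ ℚ.* ε ℚ.+ ½ ℚ.* ε             ≡⟨ half+half ε ⟩
    ε                               ∎
    where open +-*-Solver
          open ℚ.≤-Reasoning

  diff-+ : ∀ a b c d → ∣ a ℚ.- c ∣ ℚ.< ½ ℚ.* ε → ∣ b ℚ.- d ∣ ℚ.< ½ ℚ.* ε →
           ∣ (a ℚ.+ b) ℚ.- (c ℚ.+ d) ∣ ℚ.< ε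
  diff-+ {ε} a b c d p q = begin-strict
    ∣ (a ℚ.+ b) ℚ.- (c ℚ.+ d) ∣     ≡⟨ cong ∣_∣ (solve 4 (λ a b c d →
                                         (a :+ b) :- (c :+ d) := (a :- c) :+ (b :- d))
                                         refl a b c d) ⟩
    ∣ (a ℚ.- c) ℚ.+ (b ℚ.- d) ∣     ≤⟨ ℚ.∣p+q∣≤∣p∣+∣q∣ (a ℚ.- c) (b ℚ.- d) ⟩
    ∣ a ℚ.- c ∣ ℚ.+ ∣ b ℚ.- d ∣     <⟨ ℚ.+-mono-< p q ⟩
    ½ ℚ.* ε ℚ.+ ½ ℚ.* ε             ≡⟨ half+half ε ⟩
    ε                               ∎
    where open +-*-Solver
          open ℚ.≤-Reasoning

  diff-neg : ∀ a b → ∣ (ℚ.- a) ℚ.- (ℚ.- b) ∣ ≡ ∣ a ℚ.- b ∣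
  diff-neg a b = trans (cong ∣_∣
    (solve 2 (λ a b → (:- a) :- (:- b) := b :- a) refl a b)) (diff-sym b a)
    where open +-*-Solver

  diff-* : ∀ a b c d δ → 0ℚ ℚ.< B → ∣ a ∣ ℚ.≤ B → ∣ d ∣ ℚ.≤ B → B ℚ.* δ ≡ ε →
           ∣ a ℚ.- c ∣ ℚ.< ½ ℚ.* δ → ∣ b ℚ.- d ∣ ℚ.< ½ ℚ.* δ →
           ∣ a ℚ.* b ℚ.- c ℚ.* d ∣ ℚ.< ε
  diff-* {B} {ε} a b c d δ 0<B a≤B d≤B Bδ≡ε p q = begin-strict
    ∣ a ℚ.* b ℚ.- c ℚ.* d ∣
      ≡⟨ cong ∣_∣ (solve 4 (λ a b c d →
           a :* b :- c :* d := a :* (b :- d) :+ d :* (a :- c)) refl a b c d) ⟩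
    ∣ a ℚ.* (b ℚ.- d) ℚ.+ d ℚ.* (a ℚ.- c) ∣
      ≤⟨ ℚ.∣p+q∣≤∣p∣+∣q∣ (a ℚ.* (b ℚ.- d)) (d ℚ.* (a ℚ.- c)) ⟩
    ∣ a ℚ.* (b ℚ.- d) ∣ ℚ.+ ∣ d ℚ.* (a ℚ.- c) ∣
      ≡⟨ cong₂ ℚ._+_ (ℚ.∣p*q∣≡∣p∣*∣q∣ a (b ℚ.- d)) (ℚ.∣p*q∣≡∣p∣*∣q∣ d (a ℚ.- c)) ⟩
    ∣ a ∣ ℚ.* ∣ b ℚ.- d ∣ ℚ.+ ∣ d ∣ ℚ.* ∣ a ℚ.- c ∣
      ≤⟨ ℚ.+-mono-≤
           (ℚ.*-monoʳ-≤-nonNeg ∣ b ℚ.- d ∣ {{ℚ.∣-∣-nonNeg (b ℚ.- d)}} a≤B)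
           (ℚ.*-monoʳ-≤-nonNeg ∣ a ℚ.- c ∣ {{ℚ.∣-∣-nonNeg (a ℚ.- c)}} d≤B) ⟩
    B ℚ.* ∣ b ℚ.- d ∣ ℚ.+ B ℚ.* ∣ a ℚ.- c ∣
      ≡⟨ ℚ.*-distribˡ-+ B ∣ b ℚ.- d ∣ ∣ a ℚ.- c ∣ ⟨
    B ℚ.* (∣ b ℚ.- d ∣ ℚ.+ ∣ a ℚ.- c ∣)
      <⟨ ℚ.*-monoʳ-<-pos B {{ℚ.positive 0<B}} (ℚ.+-mono-< q p) ⟩
    B ℚ.* (½ ℚ.* δ ℚ.+ ½ ℚ.* δ)
      ≡⟨ cong (B ℚ.*_) (half+half δ) ⟩
    B ℚ.* δ
      ≡⟨ Bδ≡ε ⟩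
    ε ∎
    where open +-*-Solver
          open ℚ.≤-Reasoning

  quotient : ∀ B ε → 0ℚ ℚ.< B → 0ℚ ℚ.< ε → ∃[ δ ] (0ℚ ℚ.< δ × B ℚ.* δ ≡ ε)
  quotient B ε 0<B 0<ε = quotient⁺ B ε {{ℚ.positive 0<B}} {{ℚ.positive 0<ε}}
    where
    quotient⁺ : ∀ B ε .{{_ : ℚ.Positive B}} .{{_ : ℚ.Positive ε}} →
                ∃[ δ ] (0ℚ ℚ.< δ × B ℚ.* δ ≡ ε)
    quotient⁺ B ε = divide {{ℚ.pos⇒nonZero B}} {{ℚ.1/pos⇒pos B}}
      where
      divide : .{{_ : ℚ.NonZero B}} → .{{_ : ℚ.Positive (ℚ.1/ B)}} →
               ∃[ δ ] (0ℚ ℚ.< δ × B ℚ.* δ ≡ ε)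
      divide = ℚ.1/ B ℚ.* ε ,
        ℚ.positive⁻¹ (ℚ.1/ B ℚ.* ε) {{ℚ.pos*pos⇒pos (ℚ.1/ B) ε}} ,
        trans (sym (ℚ.*-assoc B (ℚ.1/ B) ε))
          (trans (cong (ℚ._* ε) (ℚ.*-inverseʳ B)) (ℚ.*-identityˡ ε))

  a≤a+b : ∀ a b → 0ℚ ℚ.≤ b → a ℚ.≤ a ℚ.+ b
  a≤a+b a b 0≤b = subst (ℚ._≤ a ℚ.+ b) (ℚ.+-identityʳ a)
    (ℚ.+-mono-≤ {a} {a} {0ℚ} {b} ℚ.≤-refl 0≤b)

  b≤a+b : ∀ a b → 0ℚ ℚ.≤ a → b ℚ.≤ a ℚ.+ b
  b≤a+b a b 0≤a = subst (b ℚ.≤_) (ℚ.+-comm b a) (a≤a+b b a 0≤a)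

  bounded : ∀ x → ∃[ B ] ∃[ N ] (0ℚ ℚ.< B × (∀ n → N ℕ.≤ n → ∣ seq x n ∣ ℚ.≤ B))
  bounded x =
    let N , close = cauchy x 1ℚ (ℚ.positive⁻¹ 1ℚ)
        b = seq x N
    in 1ℚ ℚ.+ ∣ b ∣ , N ,
       ℚ.<-≤-trans (ℚ.positive⁻¹ 1ℚ) (a≤a+b 1ℚ ∣ b ∣ (ℚ.0≤∣p∣ b)) ,
       λ n N≤n → near (seq x n) b (close n N N≤n ℕ.≤-refl)
    where
    near : ∀ a b → ∣ a ℚ.- b ∣ ℚ.< 1ℚ → ∣ a ∣ ℚ.≤ 1ℚ ℚ.+ ∣ b ∣
    near a b a-b<1 = begin
      ∣ a ∣                     ≡⟨ cong ∣_∣ (solve 2 (λ a b → a := (a :- b) :+ b)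
                                     refl a b) ⟩
      ∣ (a ℚ.- b) ℚ.+ b ∣       ≤⟨ ℚ.∣p+q∣≤∣p∣+∣q∣ (a ℚ.- b) b ⟩
      ∣ a ℚ.- b ∣ ℚ.+ ∣ b ∣     ≤⟨ ℚ.+-mono-≤ {∣ a ℚ.- b ∣} {1ℚ} {∣ b ∣} {∣ b ∣}
                                     (ℚ.<⇒≤ a-b<1) ℚ.≤-refl ⟩
      1ℚ ℚ.+ ∣ b ∣              ∎
      where open +-*-Solver
            open ℚ.≤-Reasoning

  bounded₂ : ∀ x y → ∃[ B ] ∃[ N ] (0ℚ ℚ.< B ×
               (∀ n → N ℕ.≤ n → ∣ seq x n ∣ ℚ.≤ B × ∣ seq y n ∣ ℚ.≤ B))
  bounded₂ x y =
    let A , M , 0<A , x≤A = bounded x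
        B , N , 0<B , y≤B = bounded y
    in A ℚ.+ B , M ⊔ N , ℚ.+-mono-< {0ℚ} {A} {0ℚ} {B} 0<A 0<B , λ n MN≤n →
      ℚ.≤-trans (x≤A n (ℕ.m⊔n≤o⇒m≤o M N MN≤n)) (a≤a+b A B (ℚ.<⇒≤ 0<B)) ,
      ℚ.≤-trans (y≤B n (ℕ.m⊔n≤o⇒n≤o M N MN≤n)) (b≤a+b A B (ℚ.<⇒≤ 0<A))

  cauchy-const : ∀ q → IsCauchy (λ _ → q)
  cauchy-const q ε 0<ε =
    0 , λ _ _ _ _ → subst (ℚ._< ε) (sym (diff-self q)) 0<ε

  cauchy-+ : ∀ x y → IsCauchy (λ n → seq x n ℚ.+ seq y n)
  cauchy-+ x y ε 0<ε =
    let M , p = cauchy x (½ ℚ.* ε) (half-pos 0<ε)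
        N , q = cauchy y (½ ℚ.* ε) (half-pos 0<ε)
    in M ⊔ N , λ m n ≤m ≤n →
      diff-+ (seq x m) (seq y m) (seq x n) (seq y n)
        (p m n (ℕ.m⊔n≤o⇒m≤o M N ≤m) (ℕ.m⊔n≤o⇒m≤o M N ≤n))
        (q m n (ℕ.m⊔n≤o⇒n≤o M N ≤m) (ℕ.m⊔n≤o⇒n≤o M N ≤n))

  cauchy-neg : ∀ x → IsCauchy (λ n → ℚ.- seq x n)
  cauchy-neg x ε 0<ε =
    let N , p = cauchy x ε 0<ε
    in N , λ m n ≤m ≤n →
      subst (ℚ._< ε) (sym (diff-neg (seq x m) (seq x n))) (p m n ≤m ≤n)

  cauchy-* : ∀ x y → IsCauchy (λ n → seq x n ℚ.* seq y n)
  cauchy-* x y ε 0<ε =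
    let B , K , 0<B , bd = bounded₂ x y
        δ , 0<δ , Bδ≡ε   = quotient B ε 0<B 0<ε
        M , p = cauchy x (½ ℚ.* δ) (half-pos 0<δ)
        N , q = cauchy y (½ ℚ.* δ) (half-pos 0<δ)
    in K ⊔ (M ⊔ N) , λ m n ≤m ≤n →
      let ≤m′ = ℕ.m⊔n≤o⇒n≤o K (M ⊔ N) ≤m
          ≤n′ = ℕ.m⊔n≤o⇒n≤o K (M ⊔ N) ≤n
      in diff-* (seq x m) (seq y m) (seq x n) (seq y n) δ 0<B
           (proj₁ (bd m (ℕ.m⊔n≤o⇒m≤o K (M ⊔ N) ≤m)))
           (proj₂ (bd n (ℕ.m⊔n≤o⇒m≤o K (M ⊔ N) ≤n)))
           Bδ≡ε
           (p m n (ℕ.m⊔n≤o⇒m≤o M N ≤m′) (ℕ.m⊔n≤o⇒m≤o M N ≤n′))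
           (q m n (ℕ.m⊔n≤o⇒n≤o M N ≤m′) (ℕ.m⊔n≤o⇒n≤o M N ≤n′))

fromℚ : ℚ → ℝ
fromℚ q = mkℝ (λ _ → q) (cauchy-const q)

infixl 6 _+ℝ_
infixl 7 _*ℝ_
infix  8 -ℝ_

_+ℝ_ _*ℝ_ : ℝ → ℝ → ℝ
x +ℝ y = mkℝ (λ n → seq x n ℚ.+ seq y n) (cauchy-+ x y)
x *ℝ y = mkℝ (λ n → seq x n ℚ.* seq y n) (cauchy-* x y)

-ℝ_ : ℝ → ℝ
-ℝ x = mkℝ (λ n → ℚ.- seq x n) (cauchy-neg x)

abstract
  ≈ℝ-pointwise : ∀ x y → (∀ n → seq x n ≡ seq y n) → x ≈ℝ y
  ≈ℝ-pointwise x y x≡y ε 0<ε = 0 , λ n _ →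
    subst (ℚ._< ε)
      (sym (trans (cong (λ q → ∣ q ℚ.- seq y n ∣) (x≡y n)) (diff-self (seq y n)))) 0<ε

  ≈ℝ-sym : ∀ x y → x ≈ℝ y → y ≈ℝ x
  ≈ℝ-sym x y x≈y ε 0<ε =
    let N , p = x≈y ε 0<ε
    in N , λ n ≤n → subst (ℚ._< ε) (diff-sym (seq x n) (seq y n)) (p n ≤n)

  ≈ℝ-trans : ∀ x y z → x ≈ℝ y → y ≈ℝ z → x ≈ℝ z
  ≈ℝ-trans x y z x≈y y≈z ε 0<ε =
    let M , p = x≈y (½ ℚ.* ε) (half-pos 0<ε)
        N , q = y≈z (½ ℚ.* ε) (half-pos 0<ε)
    in M ⊔ N , λ n ≤n →
      diff-trans (seq x n) (seq y n) (seq z n)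
        (p n (ℕ.m⊔n≤o⇒m≤o M N ≤n)) (q n (ℕ.m⊔n≤o⇒n≤o M N ≤n))

  +ℝ-cong : ∀ x x′ y y′ → x ≈ℝ x′ → y ≈ℝ y′ → x +ℝ y ≈ℝ x′ +ℝ y′
  +ℝ-cong x x′ y y′ x≈ y≈ ε 0<ε =
    let M , p = x≈ (½ ℚ.* ε) (half-pos 0<ε)
        N , q = y≈ (½ ℚ.* ε) (half-pos 0<ε)
    in M ⊔ N , λ n ≤n →
      diff-+ (seq x n) (seq y n) (seq x′ n) (seq y′ n)
        (p n (ℕ.m⊔n≤o⇒m≤o M N ≤n)) (q n (ℕ.m⊔n≤o⇒n≤o M N ≤n))

  -ℝ-cong : ∀ x x′ → x ≈ℝ x′ → -ℝ x ≈ℝ -ℝ x′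
  -ℝ-cong x x′ x≈ ε 0<ε =
    let N , p = x≈ ε 0<ε
    in N , λ n ≤n → subst (ℚ._< ε) (sym (diff-neg (seq x n) (seq x′ n))) (p n ≤n)

  *ℝ-cong : ∀ x x′ y y′ → x ≈ℝ x′ → y ≈ℝ y′ → x *ℝ y ≈ℝ x′ *ℝ y′
  *ℝ-cong x x′ y y′ x≈ y≈ ε 0<ε =
    let B , K , 0<B , bd = bounded₂ x y′
        δ , 0<δ , Bδ≡ε   = quotient B ε 0<B 0<ε
        M , p = x≈ (½ ℚ.* δ) (half-pos 0<δ)
        N , q = y≈ (½ ℚ.* δ) (half-pos 0<δ)
    in K ⊔ (M ⊔ N) , λ n ≤n →
      let ≤n′ = ℕ.m⊔n≤o⇒n≤o K (M ⊔ N) ≤n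
          bdₙ = bd n (ℕ.m⊔n≤o⇒m≤o K (M ⊔ N) ≤n)
      in diff-* (seq x n) (seq y n) (seq x′ n) (seq y′ n) δ 0<B
           (proj₁ bdₙ) (proj₂ bdₙ) Bδ≡ε
           (p n (ℕ.m⊔n≤o⇒m≤o M N ≤n′)) (q n (ℕ.m⊔n≤o⇒n≤o M N ≤n′))

infix 5 _+i_
record ℂ : Set where
  constructor _+i_
  field
    re im : ℝ

open ℂ

-- A record, so that the two numbers being compared can be inferred.
infix 4 _≈ℂ_
record _≈ℂ_ (z w : ℂ) : Set where
  constructor _,_
  field
    re≈ : re z ≈ℝ re w
    im≈ : im z ≈ℝ im w

open _≈ℂ_

infixl 6 _+ℂ_
infixl 7 _*ℂ_
infix  8 -ℂ_

_+ℂ_ _*ℂ_ : ℂ → ℂ → ℂ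
z +ℂ w = re z +ℝ re w +i im z +ℝ im w
z *ℂ w = re z *ℝ re w +ℝ -ℝ (im z *ℝ im w) +i re z *ℝ im w +ℝ im z *ℝ re w

-ℂ_ : ℂ → ℂ
-ℂ z = -ℝ re z +i -ℝ im z

0ℂ 1ℂ : ℂ
0ℂ = fromℚ 0ℚ +i fromℚ 0ℚ
1ℂ = fromℚ 1ℚ +i fromℚ 0ℚ

≈ℂ-pointwise : ∀ z w → (∀ n → seq (re z) n ≡ seq (re w) n) →
               (∀ n → seq (im z) n ≡ seq (im w) n) → z ≈ℂ w
≈ℂ-pointwise z w p q = ≈ℝ-pointwise (re z) (re w) p , ≈ℝ-pointwise (im z) (im w) q

+ℂ-comm : ∀ z w → z +ℂ w ≈ℂ w +ℂ z
+ℂ-comm z w = ≈ℂ-pointwise (z +ℂ w) (w +ℂ z)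
  (λ n → ℚ.+-comm (seq (re z) n) (seq (re w) n))
  (λ n → ℚ.+-comm (seq (im z) n) (seq (im w) n))

*ℂ-comm : ∀ z w → z *ℂ w ≈ℂ w *ℂ z
*ℂ-comm z w = ≈ℂ-pointwise (z *ℂ w) (w *ℂ z)
  (λ n → solve 4 (λ a b c d → a :* c :+ :- (b :* d) := c :* a :+ :- (d :* b)) refl
    (seq (re z) n) (seq (im z) n) (seq (re w) n) (seq (im w) n))
  (λ n → solve 4 (λ a b c d → a :* d :+ b :* c := c :* b :+ d :* a) refl
    (seq (re z) n) (seq (im z) n) (seq (re w) n) (seq (im w) n))
  where open +-*-Solver

*ℂ-assoc : ∀ z w v → (z *ℂ w) *ℂ v ≈ℂ z *ℂ (w *ℂ v)
*ℂ-assoc z w v = ≈ℂ-pointwise ((z *ℂ w) *ℂ v) (z *ℂ (w *ℂ v))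
  (λ n → solve 6 (λ a b c d e f →
      (a :* c :+ :- (b :* d)) :* e :+ :- ((a :* d :+ b :* c) :* f)
    := a :* (c :* e :+ :- (d :* f)) :+ :- (b :* (c :* f :+ d :* e))) refl
    (seq (re z) n) (seq (im z) n) (seq (re w) n) (seq (im w) n) (seq (re v) n) (seq (im v) n))
  (λ n → solve 6 (λ a b c d e f →
      (a :* c :+ :- (b :* d)) :* f :+ (a :* d :+ b :* c) :* e
    := a :* (c :* f :+ d :* e) :+ b :* (c :* e :+ :- (d :* f))) refl
    (seq (re z) n) (seq (im z) n) (seq (re w) n) (seq (im w) n) (seq (re v) n) (seq (im v) n))
  where open +-*-Solver

*ℂ-identityˡ : ∀ z → 1ℂ *ℂ z ≈ℂ z
*ℂ-identityˡ z = ≈ℂ-pointwise (1ℂ *ℂ z) z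
  (λ n → solve 2 (λ a b → con 1ℚ :* a :+ :- (con 0ℚ :* b) := a) refl
    (seq (re z) n) (seq (im z) n))
  (λ n → solve 2 (λ a b → con 1ℚ :* b :+ con 0ℚ :* a := b) refl
    (seq (re z) n) (seq (im z) n))
  where open +-*-Solver

*ℂ-distribˡ-+ℂ : ∀ z w v → z *ℂ (w +ℂ v) ≈ℂ (z *ℂ w) +ℂ (z *ℂ v)
*ℂ-distribˡ-+ℂ z w v = ≈ℂ-pointwise (z *ℂ (w +ℂ v)) ((z *ℂ w) +ℂ (z *ℂ v))
  (λ n → solve 6 (λ a b c d e f →
      a :* (c :+ e) :+ :- (b :* (d :+ f))
    := (a :* c :+ :- (b :* d)) :+ (a :* e :+ :- (b :* f))) refl
    (seq (re z) n) (seq (im z) n) (seq (re w) n) (seq (im w) n) (seq (re v) n) (seq (im v) n))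
  (λ n → solve 6 (λ a b c d e f →
      a :* (d :+ f) :+ b :* (c :+ e)
    := (a :* d :+ b :* c) :+ (a :* f :+ b :* e)) refl
    (seq (re z) n) (seq (im z) n) (seq (re w) n) (seq (im w) n) (seq (re v) n) (seq (im v) n))
  where open +-*-Solver

≈ℂ-isEquivalence : IsEquivalence _≈ℂ_
≈ℂ-isEquivalence = record
  { refl  = λ {z} → ≈ℂ-pointwise z z (λ _ → refl) (λ _ → refl)
  ; sym   = λ {z} {w} p →
      ≈ℝ-sym (re z) (re w) (re≈ p) , ≈ℝ-sym (im z) (im w) (im≈ p)
  ; trans = λ {z} {w} {v} p q →
      ≈ℝ-trans (re z) (re w) (re v) (re≈ p) (re≈ q) ,
      ≈ℝ-trans (im z) (im w) (im v) (im≈ p) (im≈ q)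
  }

open IsEquivalence ≈ℂ-isEquivalence using () renaming (trans to ≈ℂ-trans)

+ℂ-cong : ∀ {z z′ w w′} → z ≈ℂ z′ → w ≈ℂ w′ → z +ℂ w ≈ℂ z′ +ℂ w′
+ℂ-cong {z} {z′} {w} {w′} p q =
  +ℝ-cong (re z) (re z′) (re w) (re w′) (re≈ p) (re≈ q) ,
  +ℝ-cong (im z) (im z′) (im w) (im w′) (im≈ p) (im≈ q)

*ℂ-cong : ∀ {z z′ w w′} → z ≈ℂ z′ → w ≈ℂ w′ → z *ℂ w ≈ℂ z′ *ℂ w′
*ℂ-cong {z} {z′} {w} {w′} p q =
  +ℝ-cong (re z *ℝ re w) (re z′ *ℝ re w′) (-ℝ (im z *ℝ im w)) (-ℝ (im z′ *ℝ im w′))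
    (*ℝ-cong (re z) (re z′) (re w) (re w′) (re≈ p) (re≈ q))
    (-ℝ-cong (im z *ℝ im w) (im z′ *ℝ im w′)
      (*ℝ-cong (im z) (im z′) (im w) (im w′) (im≈ p) (im≈ q))) ,
  +ℝ-cong (re z *ℝ im w) (re z′ *ℝ im w′) (im z *ℝ re w) (im z′ *ℝ re w′)
    (*ℝ-cong (re z) (re z′) (im w) (im w′) (re≈ p) (im≈ q))
    (*ℝ-cong (im z) (im z′) (re w) (re w′) (im≈ p) (re≈ q))

ℂ-isCommutativeRing : IsCommutativeRing _≈ℂ_ _+ℂ_ _*ℂ_ -ℂ_ 0ℂ 1ℂ
ℂ-isCommutativeRing = record
  { isRing = record
    { +-isAbelianGroup = record
      { isGroup = record
        { isMonoid = record
          { isSemigroup = record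
            { isMagma = record
              { isEquivalence = ≈ℂ-isEquivalence
              ; ∙-cong        = +ℂ-cong
              }
            ; assoc = λ z w v → ≈ℂ-pointwise ((z +ℂ w) +ℂ v) (z +ℂ (w +ℂ v))
                (λ n → ℚ.+-assoc (seq (re z) n) (seq (re w) n) (seq (re v) n))
                (λ n → ℚ.+-assoc (seq (im z) n) (seq (im w) n) (seq (im v) n))
            }
          ; identity =
              (λ z → ≈ℂ-pointwise (0ℂ +ℂ z) z
                (λ n → ℚ.+-identityˡ (seq (re z) n))
                (λ n → ℚ.+-identityˡ (seq (im z) n))) ,
              (λ z → ≈ℂ-pointwise (z +ℂ 0ℂ) z
                (λ n → ℚ.+-identityʳ (seq (re z) n))
                (λ n → ℚ.+-identityʳ (seq (im z) n)))
          }
        ; inverse =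
            (λ z → ≈ℂ-pointwise ((-ℂ z) +ℂ z) 0ℂ
              (λ n → ℚ.+-inverseˡ (seq (re z) n))
              (λ n → ℚ.+-inverseˡ (seq (im z) n))) ,
            (λ z → ≈ℂ-pointwise (z +ℂ (-ℂ z)) 0ℂ
              (λ n → ℚ.+-inverseʳ (seq (re z) n))
              (λ n → ℚ.+-inverseʳ (seq (im z) n)))
        ; ⁻¹-cong = λ {z} {w} p →
            -ℝ-cong (re z) (re w) (re≈ p) , -ℝ-cong (im z) (im w) (im≈ p)
        }
      ; comm = +ℂ-comm
      }
    ; *-cong     = *ℂ-cong
    ; *-assoc    = *ℂ-assoc
    ; *-identity = *ℂ-identityˡ ,
                   λ z → ≈ℂ-trans {z *ℂ 1ℂ} (*ℂ-comm z 1ℂ) (*ℂ-identityˡ z)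
    ; distrib    = *ℂ-distribˡ-+ℂ ,
                   λ z w v → ≈ℂ-trans (*ℂ-comm (w +ℂ v) z)
                     (≈ℂ-trans (*ℂ-distribˡ-+ℂ z w v)
                       (+ℂ-cong (*ℂ-comm z w) (*ℂ-comm z v)))
    }
  ; *-comm = *ℂ-comm
  }

ℂ-commutativeRing : CommutativeRing 0ℓ 0ℓ
ℂ-commutativeRing = record { isCommutativeRing = ℂ-isCommutativeRing }

Matrix : ∀ {a} → Set a → ℕ → Set a
Matrix A w = Fin w → Fin w → A

module MatrixOps {a ℓ} (S : RawSemiring a ℓ) where
  open RawSemiring S
  open RawSemiringDefinitions S using (sum)

  infixl 7 _⊗_
  infix  4 _≋_

  1ᴹ : ∀ {w} → Matrix Carrier w
  1ᴹ i j = if does (i Fin.≟ j) then 1# else 0#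

  _⊗_ : ∀ {w} → Matrix Carrier w → Matrix Carrier w → Matrix Carrier w
  (X ⊗ Y) i j = sum λ k → X i k * Y k j

  ∏ᴹ : ∀ {n w} → Vector (Matrix Carrier w) n → Matrix Carrier w
  ∏ᴹ = Vector.foldr _⊗_ 1ᴹ

  bilinear : ∀ {w} → Vector Carrier w → Matrix Carrier w → Vector Carrier w → Carrier
  bilinear u X v = sum λ i → sum λ j → u i * X i j * v j

  _≋_ : ∀ {w} → Matrix Carrier w → Matrix Carrier w → Set ℓ
  X ≋ Y = ∀ i j → X i j ≈ Y i j

ℂ-rawSemiring : RawSemiring 0ℓ 0ℓ
ℂ-rawSemiring = Semiring.rawSemiring (CommutativeRing.semiring ℂ-commutativeRing)

open RawSemiringDefinitions ℂ-rawSemiring using () renaming (_×_ to _×ℂ_)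

Monomial : ℕ → Set
Monomial n = Vec ℕ n

-- A finite formal sum of terms c·xᵉ, in which the same monomial may occur
-- repeatedly; polynomials are such sums up to _≈ₚ_, equality of all
-- coefficients.
Poly : ℕ → Set
Poly n = List (ℂ × Monomial n)

coeff : ∀ {n} → Poly n → Monomial n → ℂ
coeff []            e = 0ℂ
coeff ((c , a) ∷ p) e = (if does (Vec.≡-dec ℕ._≟_ a e) then c else 0ℂ) +ℂ coeff p e

infix 4 _≈ₚ_
_≈ₚ_ : ∀ {n} → Poly n → Poly n → Set
p ≈ₚ q = ∀ e → coeff p e ≈ℂ coeff q e

constₚ : ∀ {n} → ℂ → Poly n
constₚ {n} c = (c , Vec.replicate n 0) ∷ []

varₚ : ∀ {n} → Fin n → Poly n
varₚ {n} i = (1ℂ , Vec.updateAt (Vec.replicate n 0) i suc) ∷ []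

_*ₚ_ : ∀ {n} → Poly n → Poly n → Poly n
_*ₚ_ = List.cartesianProductWith
  λ (c , a) (c′ , a′) → c *ℂ c′ , Vec.zipWith ℕ._+_ a a′

Poly-rawSemiring : ℕ → RawSemiring 0ℓ 0ℓ
Poly-rawSemiring n = record
  { Carrier = Poly n
  ; _≈_     = _≈ₚ_
  ; _+_     = _++_
  ; _*_     = _*ₚ_
  ; 0#      = []
  ; 1#      = constₚ 1ℂ
  }

Homogeneous : ∀ {n} → Poly n → Set
Homogeneous f = ∃[ D ] (∀ e → Vec.sum e ≢ D → coeff f e ≈ℂ 0ℂ)

IndividualDegree≤ : ∀ {n} → ℕ → Poly n → Set
IndividualDegree≤ d f = ∀ e j → d ℕ.< Vec.lookup e j → coeff f e ≈ℂ 0ℂ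

-- A term without xᵢ keeps its exponent but gets the coefficient 0.
∂ : ∀ {n} → Fin n → Poly n → Poly n
∂ i = List.map λ (c , a) → Vec.lookup a i ×ℂ c , Vec.updateAt a i ℕ.pred

∂^ : ∀ {n} → Monomial n → Poly n → Poly n
∂^ e f = Vector.foldr (λ i g → ℕ.fold g (∂ i) (Vec.lookup e i)) f λ i → i

module _ {n : ℕ} where
  open RawSemiringDefinitions (Poly-rawSemiring n) using (sum)

  linComb : ∀ {m} → Vector ℂ m → Vector (Poly n) m → Poly n
  linComb c b = sum λ k → constₚ (c k) *ₚ b k

  Span : ∀ {I : Set} → (I → Poly n) → Pred (Poly n) 0ℓ
  Span {I} g p = ∃[ m ] Σ[ c ∈ Vector ℂ m ] Σ[ ι ∈ Vector I m ] p ≈ₚ linComb c (g ∘ ι)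

  LinearlyIndependent : ∀ {m} → Vector (Poly n) m → Set
  LinearlyIndependent b = ∀ c → linComb c b ≈ₚ [] → ∀ k → c k ≈ℂ 0ℂ

  record IsBasis {m} (V : Pred (Poly n) 0ℓ) (b : Vector (Poly n) m) : Set where
    field
      inside      : ∀ k → V (b k)
      spanning    : ∀ p → V p → Σ[ c ∈ Vector ℂ m ] p ≈ₚ linComb c b
      independent : LinearlyIndependent b

  HasDimension : Pred (Poly n) 0ℓ → ℕ → Set
  HasDimension V m = Σ[ b ∈ Vector (Poly n) m ] IsBasis V b

-- HasDPD f r expresses DPD(f) = r: ranks over ℂ are not computable, so the
-- dimension is given as a relation rather than as a function.
HasDPD : ∀ {n} → Poly n → ℕ → Set
HasDPD f = HasDimension (Span λ e → ∂^ e f)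

record ROABP (n d w : ℕ) : Set where
  field
    σ   : Permutation′ n
    A   : Fin n → Fin (suc d) → Matrix ℂ w
    u v : Vector ℂ w

  open RawSemiringDefinitions (Poly-rawSemiring n) using (sum; _^_)
  open MatrixOps (Poly-rawSemiring n)

  M : Fin n → Matrix (Poly n) w
  M j r s = sum λ k → constₚ (A j k r s) *ₚ (varₚ j ^ toℕ k)

  output : Poly n
  output = bilinear (constₚ ∘ u) (∏ᴹ λ i → M (σ ⟨$⟩ʳ i)) (constₚ ∘ v)

Commutative : ∀ {n d w} → ROABP n d w → Set
Commutative P = ∀ j k j′ k′ → A j k ⊗ A j′ k′ ≋ A j′ k′ ⊗ A j k
  where open ROABP P
        open MatrixOps ℂ-rawSemiring

CommROABPComputable : ∀ {n} → ℕ → Poly n → Pred ℕ 0ℓ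
CommROABPComputable {n} d f w =
  Σ[ P ∈ ROABP n d w ] (Commutative P × f ≈ₚ ROABP.output P)

IsLeast : Pred ℕ 0ℓ → Pred ℕ 0ℓ
IsLeast S w = S w × (∀ w′ → S w′ → w ℕ.≤ w′)

-- HasCommRO d f w expresses commRO(f) = w, where d is the bound on the
-- individual degree that is part of the format of the programs.
HasCommRO : ∀ {n} → ℕ → Poly n → Pred ℕ 0ℓ
HasCommRO d f = IsLeast (CommROABPComputable d f)

{-# OPTIONS --safe #-}

-- Let b be a basis of the span V of the partial derivatives of f. As V is closed under
-- differentiation, ∂_jᵏ / k! acts on V by a matrix A_{j,k} with respect to b, and these
-- matrices commute because partial derivatives do. With u the coordinates of f and
-- v_t = b_t(0), Taylor's formula f(x) = Σ_e xᵉ/e! (∂ᵉf)(0) reads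
-- f(x) = uᵀ ∏_j (Σ_k A_{j,k} x_jᵏ) v, where the terms with k > d contribute nothing.
-- Hence f has a commutative ROABP of width dim V.

module Submission where

open import Defs
open import Data.Nat.Base using (ℕ; _≤_)
open import Data.Product.Base using (∃-syntax; _×_)

open import Algebra.Bundles using (CommutativeRing)
import Algebra.Definitions.RawSemiring as RawSemiringDefinitions
import Algebra.Properties.CommutativeMonoid.Mult as CommutativeMonoidMult
import Algebra.Properties.CommutativeSemigroup as CommutativeSemigroupProperties
import Algebra.Properties.Semiring.Mult as Mult
import Algebra.Properties.Semiring.Sum as Sum
import Algebra.Properties.Ring as RingProperties
open import Data.Bool.Base as Bool using (if_then_else_)
open import Data.Fin.Base using (Fin; zero; suc; toℕ; fromℕ<)
import Data.Fin.Permutation as Permutation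
import Data.Fin.Properties as Fin
open import Data.List.Base using ([]; _∷_; _++_)
import Data.List.Properties as List
open import Data.Nat.Base as ℕ using (zero; suc; _<_; s≤s; z≤n)
import Data.Nat.GeneralisedArithmetic as ℕ
import Data.Nat.Properties as ℕ
open import Data.Product.Base using (_,_; proj₁; proj₂)
open import Data.Rational.Base as ℚ using (ℚ; 0ℚ; 1ℚ)
import Data.Rational.Properties as ℚ
open import Data.Sum.Base using (_⊎_; inj₁; inj₂)
open import Data.Vec.Base as Vec using (lookup; updateAt; _[_]≔_; replicate)
import Data.Vec.Properties as Vec
open import Data.Vec.Functional as Vector using (Vector)
open import Function.Base using (_∘_; id)
import Relation.Binary.Reasoning.Setoid as SetoidReasoning
open import Relation.Binary.PropositionalEquality
  using (_≡_; _≢_; refl; sym; trans; cong; cong₂; subst; module ≡-Reasoning)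
open import Relation.Nullary using (Dec; yes; no; contradiction)
open import Relation.Nullary.Decidable using (does; dec-true; dec-false)

-- Commuting derivatives only say that two products of matrices represent the same operator on V;
-- linear independence of b turns this into an equation of matrices. Operators are compared through
-- the numbers (∂ᵉp)(0), on which a derivative translates the index e, so that composing derivatives
-- becomes adding exponents. Returning to coefficients divides by e!, and as ℂ comes only with its
-- ring structure, the inverses are built from rationals. No rank or elimination is computed over ℂ:
-- membership in V is an explicit combination, for which the basis returns explicit coordinates. The
-- remaining obstacle is the degree bound: ∂_jᵏ / k! exists for every k, but a program holds
-- matrices only for k ≤ d, so its output must be shown to vanish beyond the bound.

private
  variable
    m n : ℕ

module C = CommutativeRing ℂ-commutativeRing
open RawSemiringDefinitions ℂ-rawSemiring using () renaming (_×_ to _×ℂ_)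
open Mult C.semiring using (×-congʳ; ×-assoc-*; ×-comm-*)
open CommutativeMonoidMult C.+-commutativeMonoid using (×-distrib-+)
open Sum C.semiring
  using (sum; sum-cong-≋; sum-replicate-zero; ∑-comm; *-distribˡ-sum; *-distribʳ-sum;
         ∑-distrib-+; sum-remove)
open CommutativeSemigroupProperties C.*-commutativeSemigroup
  using (x∙yz≈y∙xz; x∙yz≈yx∙z; interchange)
module ≈-Reasoning = SetoidReasoning C.setoid

-- Monomials

infixr 6 _⊕_
_⊕_ : Monomial n → Monomial n → Monomial n
_⊕_ = Vec.zipWith ℕ._+_

𝟘 : Monomial n
𝟘 = replicate _ 0

single : Fin n → ℕ → Monomial n
single j k = 𝟘 [ j ]≔ k

⊕-identityˡ : (a : Monomial n) → 𝟘 ⊕ a ≡ a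
⊕-identityˡ = Vec.zipWith-identityˡ ℕ.+-identityˡ

⊕-identityʳ : (a : Monomial n) → a ⊕ 𝟘 ≡ a
⊕-identityʳ = Vec.zipWith-identityʳ ℕ.+-identityʳ

⊕-comm : (a b : Monomial n) → a ⊕ b ≡ b ⊕ a
⊕-comm = Vec.zipWith-comm ℕ.+-comm

⊕-assoc : (a b c : Monomial n) → (a ⊕ b) ⊕ c ≡ a ⊕ b ⊕ c
⊕-assoc = Vec.zipWith-assoc ℕ.+-assoc

⊕-cancelˡ : (a b c : Monomial n) → a ⊕ b ≡ a ⊕ c → b ≡ c
⊕-cancelˡ Vec.[] Vec.[] Vec.[] _ = refl
⊕-cancelˡ (x Vec.∷ a) (y Vec.∷ b) (z Vec.∷ c) eq =
  cong₂ Vec._∷_ (ℕ.+-cancelˡ-≡ x y z (Vec.∷-injectiveˡ eq))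
                (⊕-cancelˡ a b c (Vec.∷-injectiveʳ eq))

updateAt-+ : ∀ (j : Fin n) k e → updateAt e j (k ℕ.+_) ≡ single j k ⊕ e
updateAt-+ zero    k (x Vec.∷ e) = cong (_ Vec.∷_) (sym (⊕-identityˡ e))
updateAt-+ (suc j) k (x Vec.∷ e) = cong (x Vec.∷_) (updateAt-+ j k e)

single-+ : ∀ (j : Fin n) k l → single j k ⊕ single j l ≡ single j (k ℕ.+ l)
single-+ zero    k l = cong (_ Vec.∷_) (⊕-identityˡ 𝟘)
single-+ (suc j) k l = cong (0 Vec.∷_) (single-+ j k l)

single-zero : ∀ (j : Fin n) → single j 0 ≡ 𝟘
single-zero zero    = refl
single-zero (suc j) = cong (0 Vec.∷_) (single-zero j)

lookup-single-⊕ : ∀ (j : Fin n) k e → lookup (single j k ⊕ e) j ≡ k ℕ.+ lookup e j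
lookup-single-⊕ j k e =
  trans (cong (λ a → lookup a j) (sym (updateAt-+ j k e))) (Vec.lookup∘updateAt j e)

lookup-single-⊕′ : ∀ {i j : Fin n} k e → i ≢ j → lookup (single j k ⊕ e) i ≡ lookup e i
lookup-single-⊕′ {i = i} {j} k e i≢j =
  trans (cong (λ a → lookup a i) (sym (updateAt-+ j k e))) (Vec.lookup∘updateAt′ i j i≢j e)

single-⊕-∸ : ∀ (j : Fin n) {k} e → k ≤ lookup e j →
             e ≡ single j k ⊕ updateAt e j (ℕ._∸ k)
single-⊕-∸ zero    (x Vec.∷ e) k≤x =
  cong₂ Vec._∷_ (sym (ℕ.m+[n∸m]≡n k≤x)) (sym (⊕-identityˡ e))
single-⊕-∸ (suc j) (x Vec.∷ e) k≤e = cong (x Vec.∷_) (single-⊕-∸ j e k≤e)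

⨁ : Vector (Monomial n) m → Monomial n
⨁ = Vector.foldr _⊕_ 𝟘

⨁-∷-zero : (a : Vector (Monomial n) m) → ⨁ (λ i → 0 Vec.∷ a i) ≡ 0 Vec.∷ ⨁ a
⨁-∷-zero {m = zero}  a = refl
⨁-∷-zero {m = suc m} a = cong ((0 Vec.∷ a zero) ⊕_) (⨁-∷-zero (a ∘ suc))

⨁-single : (a : Monomial n) → ⨁ (λ i → single i (lookup a i)) ≡ a
⨁-single Vec.[]      = refl
⨁-single (x Vec.∷ a) = begin
  (x Vec.∷ 𝟘) ⊕ ⨁ (λ i → 0 Vec.∷ single i (lookup a i))
    ≡⟨ cong ((x Vec.∷ 𝟘) ⊕_) (⨁-∷-zero (λ i → single i (lookup a i))) ⟩
  (x ℕ.+ 0) Vec.∷ 𝟘 ⊕ ⨁ (λ i → single i (lookup a i))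
    ≡⟨ cong₂ Vec._∷_ (ℕ.+-identityʳ x) (trans (⊕-identityˡ _) (⨁-single a)) ⟩
  x Vec.∷ a ∎
  where open ≡-Reasoning

zero-vector : (e : Monomial n) → (∀ j → lookup e j ≡ 0) → e ≡ 𝟘
zero-vector Vec.[]      _  = refl
zero-vector (x Vec.∷ e) e≡0 = cong₂ Vec._∷_ (e≡0 zero) (zero-vector e (e≡0 ∘ suc))

-- Sums, factorials and their inverses

sum-zero : (t : Vector ℂ m) → (∀ i → t i C.≈ 0ℂ) → sum t C.≈ 0ℂ
sum-zero {m} t t≈0 = C.trans (sum-cong-≋ t≈0) (sum-replicate-zero m)

sum-only : (t : Vector ℂ m) (j : Fin m) → (∀ i → i ≢ j → t i C.≈ 0ℂ) → sum t C.≈ t j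
sum-only {suc m} t j t≈0 = begin
  sum t                              ≈⟨ sum-remove t ⟩
  t j +ℂ sum (Vector.removeAt t j)   ≈⟨ C.+-congˡ (sum-zero _ λ i →
                                          t≈0 _ (Fin.punchInᵢ≢i j i)) ⟩
  t j +ℂ 0ℂ                          ≈⟨ C.+-identityʳ (t j) ⟩
  t j                                ∎
  where open ≈-Reasoning

ℚ→ℂ : ℚ → ℂ
ℚ→ℂ q = fromℚ q +i fromℚ 0ℚ

-- The recursion mirrors that of `_×ℂ_`, which makes `×-ℚ→ℂ` a direct induction.
fromℕ : ℕ → ℚ
fromℕ zero    = 0ℚ
fromℕ (suc k) = 1ℚ ℚ.+ fromℕ k

fromℕ-nonNeg : ∀ k → ℚ.NonNegative (fromℕ k)
fromℕ-nonNeg zero    = _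
fromℕ-nonNeg (suc k) = ℚ.nonNeg+nonNeg⇒nonNeg 1ℚ (fromℕ k) {{fromℕ-nonNeg k}}

fromℕ-suc-pos : ∀ k → ℚ.Positive (fromℕ (suc k))
fromℕ-suc-pos k = ℚ.positive (ℚ.<-≤-trans (ℚ.positive⁻¹ 1ℚ)
  (a≤a+b 1ℚ (fromℕ k) (ℚ.nonNegative⁻¹ (fromℕ k) {{fromℕ-nonNeg k}})))

-- Characteristic zero enters here. Only positive integers have to be inverted, and for these a
-- constant sequence of rationals is enough.
suc⁻¹ : ℕ → ℂ
suc⁻¹ k = ℚ→ℂ (ℚ.1/_ (fromℕ (suc k)) {{ℚ.pos⇒nonZero (fromℕ (suc k)) {{fromℕ-suc-pos k}}}})

×-ℚ→ℂ : ∀ k q → k ×ℂ ℚ→ℂ q C.≈ ℚ→ℂ (fromℕ k ℚ.* q)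
×-ℚ→ℂ zero    q = ≈ℂ-pointwise _ _ (λ _ → sym (ℚ.*-zeroˡ q)) (λ _ → refl)
×-ℚ→ℂ (suc k) q = C.trans (C.+-congˡ (×-ℚ→ℂ k q)) (≈ℂ-pointwise _ _
  (λ _ → sym (trans (ℚ.*-distribʳ-+ q 1ℚ (fromℕ k)) (cong (ℚ._+ fromℕ k ℚ.* q) (ℚ.*-identityˡ q))))
  (λ _ → refl))

×-suc⁻¹ : ∀ k → suc k ×ℂ suc⁻¹ k C.≈ 1ℂ
×-suc⁻¹ k = C.trans (×-ℚ→ℂ (suc k) _) (≈ℂ-pointwise _ _
  (λ _ → ℚ.*-inverseʳ (fromℕ (suc k)) {{ℚ.pos⇒nonZero (fromℕ (suc k)) {{fromℕ-suc-pos k}}}})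
  (λ _ → refl))

infix 9 _! _!⁻¹
_! _!⁻¹ : ℕ → ℂ
zero  !   = 1ℂ
suc k !   = suc k ×ℂ k !
zero  !⁻¹ = 1ℂ
suc k !⁻¹ = suc⁻¹ k *ℂ k !⁻¹

!⁻¹-inverse : ∀ k → k ! *ℂ k !⁻¹ C.≈ 1ℂ
!⁻¹-inverse zero    = C.*-identityˡ 1ℂ
!⁻¹-inverse (suc k) = begin
  (suc k ×ℂ k !) *ℂ (suc⁻¹ k *ℂ k !⁻¹)  ≈⟨ ×-assoc-* (suc k) (k !) _ ⟩
  suc k ×ℂ (k ! *ℂ (suc⁻¹ k *ℂ k !⁻¹))  ≈⟨ ×-congʳ (suc k) (x∙yz≈y∙xz (k !) (suc⁻¹ k) (k !⁻¹)) ⟩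
  suc k ×ℂ (suc⁻¹ k *ℂ (k ! *ℂ k !⁻¹))  ≈⟨ ×-congʳ (suc k) (C.*-congˡ (!⁻¹-inverse k)) ⟩
  suc k ×ℂ (suc⁻¹ k *ℂ 1ℂ)              ≈⟨ ×-congʳ (suc k) (C.*-identityʳ (suc⁻¹ k)) ⟩
  suc k ×ℂ suc⁻¹ k                      ≈⟨ ×-suc⁻¹ k ⟩
  1ℂ                                    ∎
  where open ≈-Reasoning

-- For `_!` this is the multi-index factorial e!, and for `_!⁻¹` its inverse.
∏ : (ℕ → ℂ) → Monomial n → ℂ
∏ φ e = Vec.foldr′ (λ k z → φ k *ℂ z) 1ℂ e

∏-lookup : ∀ φ (e : Monomial n) → Vector.foldr _*ℂ_ 1ℂ (φ ∘ lookup e) ≡ ∏ φ e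
∏-lookup φ Vec.[]      = refl
∏-lookup φ (k Vec.∷ e) = cong (φ k *ℂ_) (∏-lookup φ e)

∏-inverse : (e : Monomial n) → ∏ _! e *ℂ ∏ _!⁻¹ e C.≈ 1ℂ
∏-inverse Vec.[]      = C.*-identityˡ 1ℂ
∏-inverse (k Vec.∷ e) = begin
  (k ! *ℂ ∏ _! e) *ℂ (k !⁻¹ *ℂ ∏ _!⁻¹ e)  ≈⟨ interchange (k !) _ _ _ ⟩
  (k ! *ℂ k !⁻¹) *ℂ (∏ _! e *ℂ ∏ _!⁻¹ e)  ≈⟨ C.*-cong (!⁻¹-inverse k) (∏-inverse e) ⟩
  1ℂ *ℂ 1ℂ                                ≈⟨ C.*-identityˡ 1ℂ ⟩
  1ℂ                                      ∎
  where open ≈-Reasoning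

∏!-single-⊕ : ∀ (i : Fin n) e → ∏ _! (single i 1 ⊕ e) C.≈ suc (lookup e i) ×ℂ ∏ _! e
∏!-single-⊕ zero (k Vec.∷ e) = begin
  suc k ! *ℂ ∏ _! (𝟘 ⊕ e)  ≡⟨ cong (λ a → suc k ! *ℂ ∏ _! a) (⊕-identityˡ e) ⟩
  suc k ! *ℂ ∏ _! e        ≈⟨ ×-assoc-* (suc k) (k !) (∏ _! e) ⟩
  suc k ×ℂ (k ! *ℂ ∏ _! e) ∎
  where open ≈-Reasoning
∏!-single-⊕ (suc i) (k Vec.∷ e) = begin
  k ! *ℂ ∏ _! (single i 1 ⊕ e)           ≈⟨ C.*-congˡ (∏!-single-⊕ i e) ⟩
  k ! *ℂ (suc (lookup e i) ×ℂ ∏ _! e)    ≈⟨ ×-comm-* (suc (lookup e i)) _ _ ⟩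
  suc (lookup e i) ×ℂ (k ! *ℂ ∏ _! e)    ∎
  where open ≈-Reasoning

-- Coefficients

termCoeff : ℂ → Monomial n → Monomial n → ℂ
termCoeff c a e = if does (Vec.≡-dec ℕ._≟_ a e) then c else 0ℂ

termCoeff-≡ : ∀ c {a e : Monomial n} → a ≡ e → termCoeff c a e ≡ c
termCoeff-≡ c {a} {e} a≡e =
  cong (if_then c else 0ℂ) (dec-true (Vec.≡-dec ℕ._≟_ a e) a≡e)

termCoeff-≢ : ∀ c {a e : Monomial n} → a ≢ e → termCoeff c a e ≡ 0ℂ
termCoeff-≢ c {a} {e} a≢e =
  cong (if_then c else 0ℂ) (dec-false (Vec.≡-dec ℕ._≟_ a e) a≢e)

coeff-++ : ∀ (p q : Poly n) e → coeff (p ++ q) e C.≈ coeff p e +ℂ coeff q e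
coeff-++ []            q e = C.sym (C.+-identityˡ (coeff q e))
coeff-++ ((c , a) ∷ p) q e = begin
  termCoeff c a e +ℂ coeff (p ++ q) e              ≈⟨ C.+-congˡ (coeff-++ p q e) ⟩
  termCoeff c a e +ℂ (coeff p e +ℂ coeff q e)      ≈⟨ C.+-assoc (termCoeff c a e) _ _ ⟨
  (termCoeff c a e +ℂ coeff p e) +ℂ coeff q e      ∎
  where open ≈-Reasoning

module Pₙ {n : ℕ} = RawSemiringDefinitions (Poly-rawSemiring n)

coeff-sum : ∀ (p : Vector (Poly n) m) e → coeff (Pₙ.sum p) e C.≈ sum (λ i → coeff (p i) e)
coeff-sum {m = zero}  p e = C.refl
coeff-sum {m = suc m} p e = C.trans (coeff-++ (p zero) (Pₙ.sum (p ∘ suc)) e)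
  (C.+-congˡ (coeff-sum (p ∘ suc) e))

termₚ : ℂ → Monomial n → Poly n
termₚ c a = (c , a) ∷ []

coeff-term-*ₚ : ∀ c a (p : Poly n) e → coeff (termₚ c a *ₚ p) (a ⊕ e) C.≈ c *ℂ coeff p e
coeff-term-*ₚ c a []             e = C.sym (C.zeroʳ c)
coeff-term-*ₚ c a ((c′ , b) ∷ p) e = begin
  termCoeff (c *ℂ c′) (a ⊕ b) (a ⊕ e) +ℂ coeff (termₚ c a *ₚ p) (a ⊕ e)
    ≈⟨ C.+-cong term (coeff-term-*ₚ c a p e) ⟩
  c *ℂ termCoeff c′ b e +ℂ c *ℂ coeff p e
    ≈⟨ C.distribˡ c (termCoeff c′ b e) (coeff p e) ⟨
  c *ℂ (termCoeff c′ b e +ℂ coeff p e) ∎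
  where
  open ≈-Reasoning
  term : termCoeff (c *ℂ c′) (a ⊕ b) (a ⊕ e) C.≈ c *ℂ termCoeff c′ b e
  term with Vec.≡-dec ℕ._≟_ b e
  ... | yes b≡e = C.reflexive (termCoeff-≡ (c *ℂ c′) (cong (a ⊕_) b≡e))
  ... | no  b≢e  = C.trans (C.reflexive (termCoeff-≢ (c *ℂ c′) (b≢e ∘ ⊕-cancelˡ a b e)))
                           (C.sym (C.zeroʳ c))

coeff-term-*ₚ-≢ : ∀ c a (p : Poly n) {e} → (∀ b → a ⊕ b ≢ e) →
                  coeff (termₚ c a *ₚ p) e C.≈ 0ℂ
coeff-term-*ₚ-≢ c a []             a⊕≢e = C.refl
coeff-term-*ₚ-≢ c a ((c′ , b) ∷ p) {e} a⊕≢e = begin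
  termCoeff (c *ℂ c′) (a ⊕ b) e +ℂ coeff (termₚ c a *ₚ p) e
    ≈⟨ C.+-cong (C.reflexive (termCoeff-≢ (c *ℂ c′) (a⊕≢e b))) (coeff-term-*ₚ-≢ c a p a⊕≢e) ⟩
  0ℂ +ℂ 0ℂ
    ≈⟨ C.+-identityˡ 0ℂ ⟩
  0ℂ ∎
  where open ≈-Reasoning

coeff-const-*ₚ : ∀ c (p : Poly n) e → coeff (constₚ c *ₚ p) e C.≈ c *ℂ coeff p e
coeff-const-*ₚ c p e = begin
  coeff (constₚ c *ₚ p) e        ≡⟨ cong (coeff (constₚ c *ₚ p)) (⊕-identityˡ e) ⟨
  coeff (constₚ c *ₚ p) (𝟘 ⊕ e)  ≈⟨ coeff-term-*ₚ c 𝟘 p e ⟩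
  c *ℂ coeff p e                 ∎
  where open ≈-Reasoning

coeff-*ₚ-const : ∀ (p : Poly n) c e → coeff (p *ₚ constₚ c) e C.≈ coeff p e *ℂ c
coeff-*ₚ-const []             c e = C.sym (C.zeroˡ c)
coeff-*ₚ-const ((c′ , a) ∷ p) c e = begin
  termCoeff (c′ *ℂ c) (a ⊕ 𝟘) e +ℂ coeff (p *ₚ constₚ c) e
    ≈⟨ C.+-cong term (coeff-*ₚ-const p c e) ⟩
  termCoeff c′ a e *ℂ c +ℂ coeff p e *ℂ c
    ≈⟨ C.distribʳ c (termCoeff c′ a e) (coeff p e) ⟨
  (termCoeff c′ a e +ℂ coeff p e) *ℂ c ∎
  where
  open ≈-Reasoning
  term : termCoeff (c′ *ℂ c) (a ⊕ 𝟘) e C.≈ termCoeff c′ a e *ℂ c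
  term rewrite ⊕-identityʳ a with Vec.≡-dec ℕ._≟_ a e
  ... | yes _ = C.refl
  ... | no  _ = C.sym (C.zeroˡ c)

coeff-linComb : ∀ (c : Vector ℂ m) (b : Vector (Poly n) m) e →
                coeff (linComb c b) e C.≈ sum λ k → c k *ℂ coeff (b k) e
coeff-linComb c b e = C.trans (coeff-sum (λ k → constₚ (c k) *ₚ b k) e)
  (sum-cong-≋ λ k → coeff-const-*ₚ (c k) (b k) e)

×-zeroʳ : ∀ k → k ×ℂ 0ℂ C.≈ 0ℂ
×-zeroʳ zero    = C.refl
×-zeroʳ (suc k) = C.trans (C.+-identityˡ (k ×ℂ 0ℂ)) (×-zeroʳ k)

single-⊕-pred : ∀ (i : Fin n) {k} a → lookup a i ≡ suc k →
                a ≡ single i 1 ⊕ updateAt a i ℕ.pred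
single-⊕-pred i a aᵢ≡suc = trans (single-⊕-∸ i {1} a (subst (1 ≤_) (sym aᵢ≡suc) (s≤s z≤n)))
  (cong (single i 1 ⊕_) (Vec.updateAt-cong i (λ { zero → refl ; (suc k) → refl }) a))

updateAt-pred-single-⊕ : ∀ (i : Fin n) e → updateAt (single i 1 ⊕ e) i ℕ.pred ≡ e
updateAt-pred-single-⊕ i e =
  trans (cong (λ a → updateAt a i ℕ.pred) (sym (updateAt-+ i 1 e)))
        (trans (Vec.updateAt-updateAt i e) (Vec.updateAt-id i e))

coeff-∂ : ∀ (i : Fin n) p e →
          coeff (∂ i p) e C.≈ suc (lookup e i) ×ℂ coeff p (single i 1 ⊕ e)
coeff-∂ i []            e = C.sym (×-zeroʳ (suc (lookup e i)))
coeff-∂ i ((c , a) ∷ p) e = begin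
  termCoeff (lookup a i ×ℂ c) (updateAt a i ℕ.pred) e +ℂ coeff (∂ i p) e
    ≈⟨ C.+-cong term (coeff-∂ i p e) ⟩
  suc eᵢ ×ℂ termCoeff c a e⁺ +ℂ suc eᵢ ×ℂ coeff p e⁺
    ≈⟨ ×-distrib-+ (termCoeff c a e⁺) (coeff p e⁺) (suc eᵢ) ⟨
  suc eᵢ ×ℂ (termCoeff c a e⁺ +ℂ coeff p e⁺) ∎
  where
  open ≈-Reasoning
  eᵢ = lookup e i
  e⁺ = single i 1 ⊕ e
  vanish : a ≢ e⁺ → ∀ k → lookup a i ≡ k → termCoeff (k ×ℂ c) (updateAt a i ℕ.pred) e ≡ 0ℂ
  vanish a≢e⁺ (suc k) aᵢ≡suc = termCoeff-≢ (suc k ×ℂ c) λ a⁻≡e →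
    a≢e⁺ (trans (single-⊕-pred i a aᵢ≡suc) (cong (single i 1 ⊕_) a⁻≡e))
  -- A term without x_i keeps its exponent under `∂`, so it may well land on `e`; both branches are
  -- 0ℂ because its new coefficient is 0 ×ℂ c.
  vanish a≢e⁺ zero _ with Vec.≡-dec ℕ._≟_ (updateAt a i ℕ.pred) e
  ... | yes _ = refl
  ... | no  _ = refl
  term : termCoeff (lookup a i ×ℂ c) (updateAt a i ℕ.pred) e C.≈ suc eᵢ ×ℂ termCoeff c a e⁺
  term with Vec.≡-dec ℕ._≟_ a e⁺
  ... | yes refl = C.reflexive (trans
          (termCoeff-≡ (lookup a i ×ℂ c) (updateAt-pred-single-⊕ i e))
          (cong (_×ℂ c) (lookup-single-⊕ i 1 e)))
  ... | no a≢e⁺ = C.trans (C.reflexive (vanish a≢e⁺ (lookup a i) refl))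
                          (C.sym (×-zeroʳ (suc eᵢ)))

-- The value (∂ᵉp)(0) = e!·coeff p e; in terms of these values, differentiation is a
-- shift, with no factors.
jet : Poly n → Monomial n → ℂ
jet p e = ∏ _! e *ℂ coeff p e

coeff-jet : ∀ (p : Poly n) e → coeff p e C.≈ ∏ _!⁻¹ e *ℂ jet p e
coeff-jet p e = begin
  coeff p e                                ≈⟨ C.*-identityˡ (coeff p e) ⟨
  1ℂ *ℂ coeff p e                          ≈⟨ C.*-congʳ (∏-inverse e) ⟨
  (∏ _! e *ℂ ∏ _!⁻¹ e) *ℂ coeff p e        ≈⟨ C.*-congʳ (C.*-comm (∏ _! e) (∏ _!⁻¹ e)) ⟩
  (∏ _!⁻¹ e *ℂ ∏ _! e) *ℂ coeff p e        ≈⟨ C.*-assoc (∏ _!⁻¹ e) (∏ _! e) _ ⟩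
  ∏ _!⁻¹ e *ℂ jet p e                      ∎
  where open ≈-Reasoning

-- As every e! is invertible, jets separate polynomials; identities between derivatives can
-- therefore be checked as identities of shifted indices.
jet-injective : ∀ {p q : Poly n} → (∀ e → jet p e C.≈ jet q e) → p ≈ₚ q
jet-injective {p = p} {q} jp≈jq e = begin
  coeff p e               ≈⟨ coeff-jet p e ⟩
  ∏ _!⁻¹ e *ℂ jet p e     ≈⟨ C.*-congˡ (jp≈jq e) ⟩
  ∏ _!⁻¹ e *ℂ jet q e     ≈⟨ coeff-jet q e ⟨
  coeff q e               ∎
  where open ≈-Reasoning

jet-cong : ∀ {p q : Poly n} → p ≈ₚ q → ∀ e → jet p e C.≈ jet q e
jet-cong p≈q e = C.*-congˡ (p≈q e)

jet-linComb : ∀ (c : Vector ℂ m) (b : Vector (Poly n) m) e →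
              jet (linComb c b) e C.≈ sum λ k → c k *ℂ jet (b k) e
jet-linComb c b e = begin
  ∏ _! e *ℂ coeff (linComb c b) e             ≈⟨ C.*-congˡ (coeff-linComb c b e) ⟩
  ∏ _! e *ℂ sum (λ k → c k *ℂ coeff (b k) e)  ≈⟨ *-distribˡ-sum (∏ _! e)
                                                   (λ k → c k *ℂ coeff (b k) e) ⟩
  sum (λ k → ∏ _! e *ℂ (c k *ℂ coeff (b k) e)) ≈⟨ sum-cong-≋ (λ k →
                                                   x∙yz≈y∙xz (∏ _! e) (c k) (coeff (b k) e)) ⟩
  sum (λ k → c k *ℂ jet (b k) e)              ∎
  where open ≈-Reasoning

-- The factor e_i + 1 produced by the derivative is exactly what turns e! into the factorial of the
-- shifted exponent.
jet-∂ : ∀ (i : Fin n) p e → jet (∂ i p) e C.≈ jet p (single i 1 ⊕ e)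
jet-∂ i p e = begin
  ∏ _! e *ℂ coeff (∂ i p) e                            ≈⟨ C.*-congˡ (coeff-∂ i p e) ⟩
  ∏ _! e *ℂ (suc (lookup e i) ×ℂ coeff p (single i 1 ⊕ e))
    ≈⟨ ×-comm-* (suc (lookup e i)) (∏ _! e) _ ⟩
  suc (lookup e i) ×ℂ (∏ _! e *ℂ coeff p (single i 1 ⊕ e))
    ≈⟨ ×-assoc-* (suc (lookup e i)) (∏ _! e) _ ⟨
  (suc (lookup e i) ×ℂ ∏ _! e) *ℂ coeff p (single i 1 ⊕ e)
    ≈⟨ C.*-congʳ (∏!-single-⊕ i e) ⟨
  jet p (single i 1 ⊕ e)                               ∎
  where open ≈-Reasoning

jet-∂-fold : ∀ (i : Fin n) p k e → jet (ℕ.fold p (∂ i) k) e C.≈ jet p (single i k ⊕ e)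
jet-∂-fold i p zero    e = C.reflexive (cong (jet p) (sym
  (trans (cong (_⊕ e) (single-zero i)) (⊕-identityˡ e))))
jet-∂-fold i p (suc k) e = begin
  jet (∂ i (ℕ.fold p (∂ i) k)) e             ≈⟨ jet-∂ i (ℕ.fold p (∂ i) k) e ⟩
  jet (ℕ.fold p (∂ i) k) (single i 1 ⊕ e)    ≈⟨ jet-∂-fold i p k (single i 1 ⊕ e) ⟩
  jet p (single i k ⊕ single i 1 ⊕ e)        ≡⟨ cong (jet p) shift ⟩
  jet p (single i (suc k) ⊕ e)               ∎
  where
  open ≈-Reasoning
  shift : single i k ⊕ single i 1 ⊕ e ≡ single i (suc k) ⊕ e
  shift = trans (sym (⊕-assoc (single i k) (single i 1) e)) (cong (_⊕ e)
    (trans (single-+ i k 1) (cong (single i) (ℕ.+-comm k 1))))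

jet-∂^ : ∀ (a : Monomial n) p e → jet (∂^ a p) e C.≈ jet p (a ⊕ e)
jet-∂^ a p e = C.trans (along id e) (C.reflexive (cong (λ a′ → jet p (a′ ⊕ e)) (⨁-single a)))
  where
  open ≈-Reasoning
  -- The fold in `∂^` runs over all variables at once; for the induction it is taken over an
  -- arbitrary family ι of them.
  along : ∀ (ι : Vector (Fin _) m) e →
          jet (Vector.foldr (λ i g → ℕ.fold g (∂ i) (lookup a i)) p ι) e C.≈
          jet p (⨁ (λ k → single (ι k) (lookup a (ι k))) ⊕ e)
  along {zero}  ι e = C.reflexive (cong (jet p) (sym (⊕-identityˡ e)))
  along {suc m} ι e = begin
    jet (ℕ.fold g (∂ (ι zero)) (lookup a (ι zero))) e
      ≈⟨ jet-∂-fold (ι zero) g (lookup a (ι zero)) e ⟩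
    jet g (s ⊕ e)
      ≈⟨ along (ι ∘ suc) (s ⊕ e) ⟩
    jet p (t ⊕ s ⊕ e)
      ≡⟨ cong (jet p) (trans (sym (⊕-assoc t s e)) (cong (_⊕ e) (⊕-comm t s))) ⟩
    jet p ((s ⊕ t) ⊕ e) ∎
    where
    g = Vector.foldr (λ i g → ℕ.fold g (∂ i) (lookup a i)) p (ι ∘ suc)
    s = single (ι zero) (lookup a (ι zero))
    t = ⨁ (λ k → single (ι (suc k)) (lookup a (ι (suc k))))

-- Composition of derivatives and closure of their span

∂^-∂^ : ∀ (a a′ : Monomial n) p → ∂^ a (∂^ a′ p) ≈ₚ ∂^ (a ⊕ a′) p
∂^-∂^ a a′ p = jet-injective λ e → begin
  jet (∂^ a (∂^ a′ p)) e     ≈⟨ jet-∂^ a (∂^ a′ p) e ⟩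
  jet (∂^ a′ p) (a ⊕ e)      ≈⟨ jet-∂^ a′ p (a ⊕ e) ⟩
  jet p (a′ ⊕ a ⊕ e)         ≡⟨ cong (jet p) (trans (sym (⊕-assoc a′ a e))
                                  (cong (_⊕ e) (⊕-comm a′ a))) ⟩
  jet p ((a ⊕ a′) ⊕ e)       ≈⟨ jet-∂^ (a ⊕ a′) p e ⟨
  jet (∂^ (a ⊕ a′) p) e      ∎
  where open ≈-Reasoning

self∈Span-∂^ : (f : Poly n) → Span (λ e → ∂^ e f) f
self∈Span-∂^ f = 1 , (λ _ → 1ℂ) , (λ _ → 𝟘) , jet-injective λ e → begin
  jet f e                                 ≡⟨ cong (jet f) (⊕-identityˡ e) ⟨
  jet f (𝟘 ⊕ e)                           ≈⟨ jet-∂^ 𝟘 f e ⟨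
  jet (∂^ 𝟘 f) e                          ≈⟨ C.*-identityˡ _ ⟨
  1ℂ *ℂ jet (∂^ 𝟘 f) e                    ≈⟨ C.+-identityʳ _ ⟨
  1ℂ *ℂ jet (∂^ 𝟘 f) e +ℂ 0ℂ              ≈⟨ jet-linComb {1} (λ _ → 1ℂ) (λ _ → ∂^ 𝟘 f) e ⟨
  jet (linComb {m = 1} (λ _ → 1ℂ) (λ _ → ∂^ 𝟘 f)) e ∎
  where open ≈-Reasoning

-- By linearity the coefficients of the combination stay the same, and only the orders of the
-- derivatives of f are shifted by a.
∂^-closed-Span : ∀ (f : Poly n) a {p} → Span (λ e → ∂^ e f) p → Span (λ e → ∂^ e f) (∂^ a p)
∂^-closed-Span f a {p} (m , c , ι , p≈) = m , c , (λ k → a ⊕ ι k) , jet-injective λ e → begin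
  jet (∂^ a p) e                                  ≈⟨ jet-∂^ a p e ⟩
  jet p (a ⊕ e)                                   ≈⟨ jet-cong p≈ (a ⊕ e) ⟩
  jet (linComb c (λ k → ∂^ (ι k) f)) (a ⊕ e)      ≈⟨ jet-linComb c (λ k → ∂^ (ι k) f) (a ⊕ e) ⟩
  sum (λ k → c k *ℂ jet (∂^ (ι k) f) (a ⊕ e))     ≈⟨ sum-cong-≋ (λ k → C.*-congˡ (shift k e)) ⟩
  sum (λ k → c k *ℂ jet (∂^ (a ⊕ ι k) f) e)       ≈⟨ jet-linComb c (λ k → ∂^ (a ⊕ ι k) f) e ⟨
  jet (linComb c (λ k → ∂^ (a ⊕ ι k) f)) e        ∎
  where
  open ≈-Reasoning
  shift : ∀ k e → jet (∂^ (ι k) f) (a ⊕ e) C.≈ jet (∂^ (a ⊕ ι k) f) e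
  shift k e = C.trans (C.sym (jet-∂^ a (∂^ (ι k) f) e)) (jet-cong (∂^-∂^ a (ι k) f) e)

-- Matrices acting on the jets of a family of polynomials

module Mℂ = MatrixOps ℂ-rawSemiring
module Mₚ {n : ℕ} = MatrixOps (Poly-rawSemiring n)

bilinear-cong : ∀ (u : Vector ℂ m) X Y v → X Mℂ.≋ Y → Mℂ.bilinear u X v C.≈ Mℂ.bilinear u Y v
bilinear-cong u X Y v X≋Y = sum-cong-≋ λ s → sum-cong-≋ λ t → C.*-congʳ (C.*-congˡ (X≋Y s t))

bilinear-zero : ∀ (u : Vector ℂ m) X v → (∀ s t → X s t C.≈ 0ℂ) → Mℂ.bilinear u X v C.≈ 0ℂ
bilinear-zero u X v X≋0 = sum-zero _ λ s → sum-zero _ λ t → begin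
  u s *ℂ X s t *ℂ v t  ≈⟨ C.*-congʳ (C.*-congˡ (X≋0 s t)) ⟩
  u s *ℂ 0ℂ *ℂ v t     ≈⟨ C.*-congʳ (C.zeroʳ (u s)) ⟩
  0ℂ *ℂ v t            ≈⟨ C.zeroˡ (v t) ⟩
  0ℂ                   ∎
  where open ≈-Reasoning

-- On the family b, the matrix X acts as κ·∂ᵃ.
Acts : Vector (Poly n) m → Matrix ℂ m → ℂ → Monomial n → Set
Acts b X κ a = ∀ s e → sum (λ t → X s t *ℂ jet (b t) e) C.≈ κ *ℂ jet (b s) (a ⊕ e)

acts-1ᴹ : (b : Vector (Poly n) m) → Acts b Mℂ.1ᴹ 1ℂ 𝟘
acts-1ᴹ b s e = begin
  sum (λ t → Mℂ.1ᴹ s t *ℂ jet (b t) e)   ≈⟨ sum-only (λ t → Mℂ.1ᴹ s t *ℂ jet (b t) e) s off ⟩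
  Mℂ.1ᴹ s s *ℂ jet (b s) e               ≈⟨ C.*-congʳ (C.reflexive
                                              (cong (if_then 1ℂ else 0ℂ) (dec-true (s Fin.≟ s) refl))) ⟩
  1ℂ *ℂ jet (b s) e                      ≡⟨ cong (λ a → 1ℂ *ℂ jet (b s) a) (⊕-identityˡ e) ⟨
  1ℂ *ℂ jet (b s) (𝟘 ⊕ e)                ∎
  where
  open ≈-Reasoning
  off : ∀ t → t ≢ s → Mℂ.1ᴹ s t *ℂ jet (b t) e C.≈ 0ℂ
  off t t≢s = C.trans (C.*-congʳ (C.reflexive
    (cong (if_then 1ℂ else 0ℂ) (dec-false (s Fin.≟ t) (t≢s ∘ sym))))) (C.zeroˡ (jet (b t) e))

-- Rows hold coordinates, so in `X ⊗ Y` the operator of X is the inner one. This is why `actsX` is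
-- used at the index `a′ ⊕ e`, and why `Acts` has to quantify over all exponents. Scalars and shifts
-- commute, so the order leaves no trace in the result.
acts-⊗ : ∀ (b : Vector (Poly n) m) {X Y κ κ′ a a′} → Acts b X κ a → Acts b Y κ′ a′ →
         Acts b (X Mℂ.⊗ Y) (κ *ℂ κ′) (a ⊕ a′)
acts-⊗ b {X} {Y} {κ} {κ′} {a} {a′} actsX actsY s e = begin
  sum (λ t → (X Mℂ.⊗ Y) s t *ℂ jet (b t) e)
    ≈⟨ sum-cong-≋ (λ t → *-distribʳ-sum (jet (b t) e) (λ k → X s k *ℂ Y k t)) ⟩
  sum (λ t → sum λ k → (X s k *ℂ Y k t) *ℂ jet (b t) e)
    ≈⟨ ∑-comm (λ t k → (X s k *ℂ Y k t) *ℂ jet (b t) e) ⟩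
  sum (λ k → sum λ t → (X s k *ℂ Y k t) *ℂ jet (b t) e)
    ≈⟨ sum-cong-≋ row ⟩
  sum (λ k → κ′ *ℂ (X s k *ℂ jet (b k) (a′ ⊕ e)))
    ≈⟨ *-distribˡ-sum κ′ (λ k → X s k *ℂ jet (b k) (a′ ⊕ e)) ⟨
  κ′ *ℂ sum (λ k → X s k *ℂ jet (b k) (a′ ⊕ e))
    ≈⟨ C.*-congˡ (actsX s (a′ ⊕ e)) ⟩
  κ′ *ℂ (κ *ℂ jet (b s) (a ⊕ a′ ⊕ e))
    ≈⟨ x∙yz≈yx∙z κ′ κ _ ⟩
  (κ *ℂ κ′) *ℂ jet (b s) (a ⊕ a′ ⊕ e)
    ≡⟨ cong (λ c → (κ *ℂ κ′) *ℂ jet (b s) c) (⊕-assoc a a′ e) ⟨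
  (κ *ℂ κ′) *ℂ jet (b s) ((a ⊕ a′) ⊕ e) ∎
  where
  open ≈-Reasoning
  row : ∀ k → sum (λ t → (X s k *ℂ Y k t) *ℂ jet (b t) e) C.≈
              κ′ *ℂ (X s k *ℂ jet (b k) (a′ ⊕ e))
  row k = begin
    sum (λ t → (X s k *ℂ Y k t) *ℂ jet (b t) e)
      ≈⟨ sum-cong-≋ (λ t → C.*-assoc (X s k) (Y k t) (jet (b t) e)) ⟩
    sum (λ t → X s k *ℂ (Y k t *ℂ jet (b t) e))
      ≈⟨ *-distribˡ-sum (X s k) (λ t → Y k t *ℂ jet (b t) e) ⟨
    X s k *ℂ sum (λ t → Y k t *ℂ jet (b t) e)
      ≈⟨ C.*-congˡ (actsY k e) ⟩
    X s k *ℂ (κ′ *ℂ jet (b k) (a′ ⊕ e))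
      ≈⟨ x∙yz≈y∙xz (X s k) κ′ _ ⟩
    κ′ *ℂ (X s k *ℂ jet (b k) (a′ ⊕ e)) ∎

acts-∏ᴹ : ∀ {k} (b : Vector (Poly n) m) (X : Vector (Matrix ℂ m) k) κ a →
          (∀ i → Acts b (X i) (κ i) (a i)) →
          Acts b (Mℂ.∏ᴹ X) (Vector.foldr _*ℂ_ 1ℂ κ) (⨁ a)
acts-∏ᴹ {k = zero}  b X κ a acts = acts-1ᴹ b
acts-∏ᴹ {k = suc k} b X κ a acts =
  acts-⊗ b (acts zero) (acts-∏ᴹ b (X ∘ suc) (κ ∘ suc) (a ∘ suc) (acts ∘ suc))

-- Each row of X - Y consists of the coefficients of a vanishing combination of the family, so
-- independence makes it zero.
acts-unique : ∀ (b : Vector (Poly n) m) → LinearlyIndependent b → ∀ {X Y κ κ′ a a′} →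
              Acts b X κ a → Acts b Y κ′ a′ → κ C.≈ κ′ → a ≡ a′ → X Mℂ.≋ Y
acts-unique b independent {X} {Y} {κ} {κ′} {a} actsX actsY κ≈κ′ refl s t =
  x∙y⁻¹≈ε⇒x≈y (X s t) (Y s t) (independent (λ k → X s k +ℂ -ℂ Y s k)
    (jet-injective {q = []} difference) t)
  where
  open ≈-Reasoning
  open RingProperties C.ring using (-1*x≈-x; x∙y⁻¹≈ε⇒x≈y)
  difference : ∀ e → jet (linComb (λ k → X s k +ℂ -ℂ Y s k) b) e C.≈ jet [] e
  difference e = begin
    jet (linComb (λ k → X s k +ℂ -ℂ Y s k) b) e
      ≈⟨ jet-linComb (λ k → X s k +ℂ -ℂ Y s k) b e ⟩
    sum (λ k → (X s k +ℂ -ℂ Y s k) *ℂ jet (b k) e)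
      ≈⟨ sum-cong-≋ (λ k → C.distribʳ (jet (b k) e) (X s k) (-ℂ Y s k)) ⟩
    sum (λ k → X s k *ℂ jet (b k) e +ℂ (-ℂ Y s k) *ℂ jet (b k) e)
      ≈⟨ ∑-distrib-+ (λ k → X s k *ℂ jet (b k) e) (λ k → (-ℂ Y s k) *ℂ jet (b k) e) ⟩
    sum (λ k → X s k *ℂ jet (b k) e) +ℂ sum (λ k → (-ℂ Y s k) *ℂ jet (b k) e)
      ≈⟨ C.+-cong (actsX s e) negY ⟩
    κ *ℂ jet (b s) (a ⊕ e) +ℂ -ℂ (κ *ℂ jet (b s) (a ⊕ e))
      ≈⟨ C.-‿inverseʳ _ ⟩
    0ℂ
      ≈⟨ C.zeroʳ (∏ _! e) ⟨
    jet [] e ∎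
    where
    negY : sum (λ k → (-ℂ Y s k) *ℂ jet (b k) e) C.≈ -ℂ (κ *ℂ jet (b s) (a ⊕ e))
    negY = begin
      sum (λ k → (-ℂ Y s k) *ℂ jet (b k) e)
        ≈⟨ sum-cong-≋ (λ k → C.trans (C.*-congʳ (C.sym (-1*x≈-x (Y s k))))
             (C.*-assoc (-ℂ 1ℂ) (Y s k) (jet (b k) e))) ⟩
      sum (λ k → (-ℂ 1ℂ) *ℂ (Y s k *ℂ jet (b k) e))
        ≈⟨ *-distribˡ-sum (-ℂ 1ℂ) (λ k → Y s k *ℂ jet (b k) e) ⟨
      (-ℂ 1ℂ) *ℂ sum (λ k → Y s k *ℂ jet (b k) e)
        ≈⟨ C.*-congˡ (C.trans (actsY s e) (C.*-congʳ (C.sym κ≈κ′))) ⟩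
      (-ℂ 1ℂ) *ℂ (κ *ℂ jet (b s) (a ⊕ e))
        ≈⟨ -1*x≈-x _ ⟩
      -ℂ (κ *ℂ jet (b s) (a ⊕ e)) ∎

-- Coefficients of the product of the matrices M_j

-- The scalar is an iterated product of 1ℂ, equal to 1ℂ only up to `_≈ℂ_`. Leaving it existential
-- keeps the equation between polynomials propositional, so it can be rewritten under `_*ₚ_` by
-- `cong`.
powerₚ : ∀ (j : Fin n) k → ∃[ c ] (c C.≈ 1ℂ × varₚ j Pₙ.^ k ≡ termₚ c (single j k))
powerₚ j zero    = 1ℂ , C.refl , cong (termₚ 1ℂ) (sym (single-zero j))
powerₚ j (suc k) with powerₚ j k
... | c , c≈1 , xᵏ≡ = 1ℂ *ℂ c , C.trans (C.*-identityˡ c) c≈1 , (begin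
  varₚ j *ₚ (varₚ j Pₙ.^ k)                                ≡⟨ cong (varₚ j *ₚ_) xᵏ≡ ⟩
  termₚ (1ℂ *ℂ c) (updateAt 𝟘 j suc ⊕ single j k)          ≡⟨ cong (termₚ (1ℂ *ℂ c)) exponent ⟩
  termₚ (1ℂ *ℂ c) (single j (suc k))                       ∎)
  where
  open ≡-Reasoning
  exponent : updateAt 𝟘 j suc ⊕ single j k ≡ single j (suc k)
  exponent = trans
    (cong (_⊕ single j k) (trans (updateAt-+ j 1 𝟘) (⊕-identityʳ (single j 1))))
    (single-+ j 1 k)

monomialₚ : ∀ c (j : Fin n) k →
            ∃[ c′ ] (c′ C.≈ c × constₚ c *ₚ (varₚ j Pₙ.^ k) ≡ termₚ c′ (single j k))
monomialₚ c j k with powerₚ j k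
... | x , x≈1 , xᵏ≡ = c *ℂ x , C.trans (C.*-congˡ x≈1) (C.*-identityʳ c) ,
  trans (cong (constₚ c *ₚ_) xᵏ≡) (cong (termₚ (c *ℂ x)) (⊕-identityˡ (single j k)))

coeff-monomial-*ₚ : ∀ c (j : Fin n) k q e →
  coeff ((constₚ c *ₚ (varₚ j Pₙ.^ k)) *ₚ q) (single j k ⊕ e) C.≈ c *ℂ coeff q e
coeff-monomial-*ₚ c j k q e = let c′ , c′≈c , eq = monomialₚ c j k in
  C.trans (C.reflexive (cong (λ p → coeff (p *ₚ q) (single j k ⊕ e)) eq))
    (C.trans (coeff-term-*ₚ c′ (single j k) q e) (C.*-congʳ c′≈c))

coeff-monomial-*ₚ-< : ∀ c (j : Fin n) k q e → lookup e j < k →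
  coeff ((constₚ c *ₚ (varₚ j Pₙ.^ k)) *ₚ q) e C.≈ 0ℂ
coeff-monomial-*ₚ-< c j k q e eⱼ<k = let c′ , _ , eq = monomialₚ c j k in
  C.trans (C.reflexive (cong (λ p → coeff (p *ₚ q) e) eq))
    (coeff-term-*ₚ-≢ c′ (single j k) q λ b kb≡e →
      ℕ.<⇒≱ eⱼ<k (subst (k ≤_)
        (trans (sym (lookup-single-⊕ j k b)) (cong (λ a → lookup a j) kb≡e))
        (ℕ.m≤m+n k (lookup b j))))

sum-*ₚ : ∀ (p : Vector (Poly n) m) q → Pₙ.sum p *ₚ q ≡ Pₙ.sum λ i → p i *ₚ q
sum-*ₚ {m = zero}  p q = refl
sum-*ₚ {m = suc m} p q = trans
  (List.cartesianProductWith-distribʳ-++ _ (p zero) (Pₙ.sum (p ∘ suc)) q)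
  (cong ((p zero *ₚ q) ++_) (sum-*ₚ (p ∘ suc) q))

-- Output of the program with given coefficient matrices

module _ {n w : ℕ} (d : ℕ) (T : Fin n → ℕ → Matrix ℂ w) where

  -- `T` is indexed by all natural numbers so that `T j (lookup e j)` makes sense without a proof
  -- that e_j ≤ d; the program itself reads only k ≤ d.
  program : Vector ℂ w → Vector ℂ w → ROABP n d w
  program u v = record { σ = Permutation.id ; A = λ j k → T j (toℕ k) ; u = u ; v = v }

  -- Definitionally the matrix `ROABP.M` of `program u v`, whatever u and v are.
  factor : Fin n → Matrix (Poly n) w
  factor j r s = Pₙ.sum λ (k : Fin (suc d)) → constₚ (T j (toℕ k) r s) *ₚ (varₚ j Pₙ.^ toℕ k)

  monomial-* : Matrix (Poly n) w → Fin n → Fin w → Fin w → Fin w → Fin (suc d) → Poly n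
  monomial-* Q j r s t k = (constₚ (T j (toℕ k) r t) *ₚ (varₚ j Pₙ.^ toℕ k)) *ₚ Q t s

  coeff-factor-⊗ : ∀ Q j r s e → coeff ((factor j Mₚ.⊗ Q) r s) e C.≈
                   sum λ t → sum λ k → coeff (monomial-* Q j r s t k) e
  coeff-factor-⊗ Q j r s e = C.trans (coeff-sum (λ t → factor j r t *ₚ Q t s) e)
    (sum-cong-≋ λ t → C.trans
      (C.reflexive (cong (λ p → coeff p e) (sum-*ₚ
        (λ (k : Fin (suc d)) → constₚ (T j (toℕ k) r t) *ₚ (varₚ j Pₙ.^ toℕ k)) (Q t s))))
      (coeff-sum (monomial-* Q j r s t) e))

  -- Either x_jᵏ does not divide xᵉ, or the coefficient is a multiple of that of `Q t s` at the
  -- quotient, to which the hypothesis applies.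
  coeff-monomial-*-≈0 : ∀ Q j r s t k e →
    (∀ e′ → e ≡ single j (toℕ k) ⊕ e′ → coeff (Q t s) e′ C.≈ 0ℂ) →
    coeff (monomial-* Q j r s t k) e C.≈ 0ℂ
  coeff-monomial-*-≈0 Q j r s t k e Q≈0 with toℕ k ℕ.≤? lookup e j
  ... | no  k≰eⱼ = coeff-monomial-*ₚ-< (T j (toℕ k) r t) j (toℕ k) (Q t s) e (ℕ.≰⇒> k≰eⱼ)
  ... | yes k≤eⱼ = begin
    coeff (monomial-* Q j r s t k) e
      ≡⟨ cong (coeff (monomial-* Q j r s t k)) e≡ ⟩
    coeff (monomial-* Q j r s t k) (single j (toℕ k) ⊕ e′)
      ≈⟨ coeff-monomial-*ₚ (T j (toℕ k) r t) j (toℕ k) (Q t s) e′ ⟩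
    T j (toℕ k) r t *ℂ coeff (Q t s) e′
      ≈⟨ C.*-congˡ (Q≈0 e′ e≡) ⟩
    T j (toℕ k) r t *ℂ 0ℂ
      ≈⟨ C.zeroʳ _ ⟩
    0ℂ ∎
    where
    open ≈-Reasoning
    e′ = updateAt e j (ℕ._∸ toℕ k)
    e≡ = single-⊕-∸ j e k≤eⱼ

  Injective : (Fin m → Fin n) → Set
  Injective ι = ∀ {i i′} → ι i ≡ ι i′ → i ≡ i′

  -- k is larger than the degree in x_j of the product of the M_(ι i).
  Excessive : (Fin m → Fin n) → Fin n → ℕ → Set
  Excessive ι j k = d < k ⊎ (0 < k × (∀ i → ι i ≢ j))

  excessive-pos : ∀ {ι : Fin m → Fin n} {j k} → Excessive ι j k → 0 < k
  excessive-pos (inj₁ d<k)       = ℕ.≤-<-trans z≤n d<k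
  excessive-pos (inj₂ (0<k , _)) = 0<k

  remainder-pos : ∀ {k} l → k ≤ d → d < k ℕ.+ l → 0 < l
  remainder-pos {k} zero    k≤d d< = contradiction k≤d (ℕ.<⇒≱ (subst (d <_) (ℕ.+-identityʳ k) d<))
  remainder-pos     (suc l) k≤d d< = s≤s z≤n

  -- Excess is inherited by the remaining factors when the first is split off, until the empty
  -- product, which has only constant entries. The two forms of excess are both needed: splitting
  -- off M_j itself turns the first into the second.
  coeff-∏ᴹ-excessive : ∀ (ι : Fin m → Fin n) → Injective ι → ∀ j e →
                       Excessive ι j (lookup e j) →
                       ∀ r s → coeff (Mₚ.∏ᴹ (factor ∘ ι) r s) e C.≈ 0ℂ
  coeff-∏ᴹ-excessive {zero} ι inj j e exc r s with does (r Fin.≟ s)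
  ... | Bool.false = C.refl
  ... | Bool.true  = C.trans (C.+-identityʳ _) (C.reflexive (termCoeff-≢ 1ℂ {𝟘} {e} λ 𝟘≡e →
    ℕ.<⇒≢ (excessive-pos {ι = ι} exc)
      (trans (sym (Vec.lookup-replicate j 0)) (cong (λ a → lookup a j) 𝟘≡e))))
  coeff-∏ᴹ-excessive {suc m} ι inj j e exc r s = begin
    coeff ((factor (ι zero) Mₚ.⊗ Q) r s) e
      ≈⟨ coeff-factor-⊗ Q (ι zero) r s e ⟩
    sum (λ t → sum λ k → coeff (monomial-* Q (ι zero) r s t k) e)
      ≈⟨ sum-zero _ (λ t → sum-zero _ λ k →
           coeff-monomial-*-≈0 Q (ι zero) r s t k e λ e′ e≡ →
             coeff-∏ᴹ-excessive (ι ∘ suc) (Fin.suc-injective ∘ inj) j e′ (rest k e′ e≡ exc) t s) ⟩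
    0ℂ ∎
    where
    open ≈-Reasoning
    Q = Mₚ.∏ᴹ (factor ∘ ι ∘ suc)
    rest : ∀ (k : Fin (suc d)) e′ → e ≡ single (ι zero) (toℕ k) ⊕ e′ →
           Excessive ι j (lookup e j) → Excessive (ι ∘ suc) j (lookup e′ j)
    rest k e′ refl exc with j Fin.≟ ι zero
    rest k e′ refl (inj₁ d<) | no j≢ =
      inj₁ (subst (d <_) (lookup-single-⊕′ (toℕ k) e′ j≢) d<)
    rest k e′ refl (inj₂ (0< , ι≢j)) | no j≢ =
      inj₂ (subst (0 <_) (lookup-single-⊕′ (toℕ k) e′ j≢) 0< , ι≢j ∘ suc)
    rest k e′ refl (inj₂ (_ , ι≢j)) | yes j≡ = contradiction (sym j≡) (ι≢j zero)
    -- M_j supplies degree at most d, so some power of x_j is left over, and by injectivity no later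
    -- factor can supply it.
    rest k e′ refl (inj₁ d<) | yes refl = inj₂
      ( remainder-pos (lookup e′ j) (Fin.toℕ≤pred[n] k) (subst (d <_) (lookup-single-⊕ j (toℕ k) e′) d<)
      , λ i ιi≡ι0 → contradiction (inj ιi≡ι0) λ () )

  ∏ᴹ-cong : ∀ {X Y : Vector (Matrix ℂ w) m} → (∀ i → X i Mℂ.≋ Y i) → Mℂ.∏ᴹ X Mℂ.≋ Mℂ.∏ᴹ Y
  ∏ᴹ-cong {zero}  X≋Y r s = C.refl
  ∏ᴹ-cong {suc m} X≋Y r s =
    sum-cong-≋ λ t → C.*-cong (X≋Y zero r t) (∏ᴹ-cong (X≋Y ∘ suc) t s)

  -- Only the term x_jᵏ with k = e_j of the first factor M_j contributes to xᵉ, as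
  -- x_j does not occur in the others.
  coeff-∏ᴹ : ∀ (ι : Fin m → Fin n) → Injective ι → ∀ e → (∀ j → lookup e j ≤ d) →
             (∀ j → (∀ i → ι i ≢ j) → lookup e j ≡ 0) → ∀ r s →
             coeff (Mₚ.∏ᴹ (factor ∘ ι) r s) e C.≈ Mℂ.∏ᴹ (λ i → T (ι i) (lookup e (ι i))) r s
  coeff-∏ᴹ {zero} ι inj e e≤d e≡0 r s with does (r Fin.≟ s)
  ... | Bool.false = C.refl
  ... | Bool.true  = C.trans (C.+-identityʳ _) (C.reflexive
    (termCoeff-≡ 1ℂ {𝟘} {e} (sym (zero-vector e λ j → e≡0 j λ ()))))
  coeff-∏ᴹ {suc m} ι inj e e≤d e≡0 r s = begin
    coeff ((factor j Mₚ.⊗ Q) r s) e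
      ≈⟨ coeff-factor-⊗ Q j r s e ⟩
    sum (λ t → sum λ k → coeff (monomial-* Q j r s t k) e)
      ≈⟨ sum-cong-≋ (λ t → C.trans (sum-only (λ k → coeff (monomial-* Q j r s t k) e) k₀ (off t))
                                   (main t)) ⟩
    sum (λ t → T j (lookup e j) r t *ℂ Mℂ.∏ᴹ (λ i → T (ι (suc i)) (lookup e (ι (suc i)))) t s) ∎
    where
    open ≈-Reasoning
    j  = ι zero
    Q  = Mₚ.∏ᴹ (factor ∘ ι ∘ suc)
    k₀ = fromℕ< (s≤s (e≤d j))
    k₀≡ : toℕ k₀ ≡ lookup e j
    k₀≡ = Fin.toℕ-fromℕ< (s≤s (e≤d j))
    inj′ : Injective (ι ∘ suc)
    inj′ = Fin.suc-injective ∘ inj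
    ι≢j : ∀ i → ι (suc i) ≢ j
    ι≢j i ιi≡j = contradiction (inj ιi≡j) λ ()
    off : ∀ t k → k ≢ k₀ → coeff (monomial-* Q j r s t k) e C.≈ 0ℂ
    -- Since k + e″_j = e_j, any k other than e_j leaves a positive power of x_j to factors that do
    -- not contain x_j.
    off t k k≢ = coeff-monomial-*-≈0 Q j r s t k e λ e″ e≡ →
      coeff-∏ᴹ-excessive (ι ∘ suc) inj′ j e″
        (inj₂ (ℕ.n≢0⇒n>0 (λ e″ⱼ≡0 → k≢ (Fin.toℕ-injective (trans (sym (ℕ.+-identityʳ (toℕ k)))
          (trans (cong (toℕ k ℕ.+_) (sym e″ⱼ≡0)) (trans (sym (lookup-single-⊕ j (toℕ k) e″))
            (trans (cong (λ a → lookup a j) (sym e≡)) (sym k₀≡))))))) , ι≢j)) t s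
    e′ = e [ j ]≔ 0
    e≡ : e ≡ single j (toℕ k₀) ⊕ e′
    e≡ = trans (single-⊕-∸ j e (ℕ.≤-reflexive k₀≡)) (cong (single j (toℕ k₀) ⊕_)
      (Vec.updateAt-cong-local j e (trans (cong (lookup e j ℕ.∸_) k₀≡) (ℕ.n∸n≡0 (lookup e j)))))
    e′ⱼ : lookup e′ j ≡ 0
    e′ⱼ = Vec.lookup∘updateAt j e
    e′ᵢ : ∀ {i} → i ≢ j → lookup e′ i ≡ lookup e i
    e′ᵢ i≢j = Vec.lookup∘updateAt′ _ j i≢j e
    e′≤d : ∀ i → lookup e′ i ≤ d
    e′≤d i with i Fin.≟ j
    ... | yes refl = subst (_≤ d) (sym e′ⱼ) z≤n
    ... | no  i≢j  = subst (_≤ d) (sym (e′ᵢ i≢j)) (e≤d i)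
    -- A variable read by none of the remaining factors is either j, whose exponent was just
    -- cleared, or was absent before.
    e′≡0 : ∀ i → (∀ k → ι (suc k) ≢ i) → lookup e′ i ≡ 0
    e′≡0 i ι≢i with i Fin.≟ j
    ... | yes refl = e′ⱼ
    ... | no  i≢j  = trans (e′ᵢ i≢j) (e≡0 i λ { zero → i≢j ∘ sym ; (suc k) → ι≢i k })
    main : ∀ t → coeff (monomial-* Q j r s t k₀) e C.≈
           T j (lookup e j) r t *ℂ Mℂ.∏ᴹ (λ i → T (ι (suc i)) (lookup e (ι (suc i)))) t s
    main t = begin
      coeff (monomial-* Q j r s t k₀) e
        ≡⟨ cong (coeff (monomial-* Q j r s t k₀)) e≡ ⟩
      coeff (monomial-* Q j r s t k₀) (single j (toℕ k₀) ⊕ e′)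
        ≈⟨ coeff-monomial-*ₚ (T j (toℕ k₀) r t) j (toℕ k₀) (Q t s) e′ ⟩
      T j (toℕ k₀) r t *ℂ coeff (Q t s) e′
        ≈⟨ C.*-cong (C.reflexive (cong (λ k → T j k r t) k₀≡))
             (coeff-∏ᴹ (ι ∘ suc) inj′ e′ e′≤d e′≡0 t s) ⟩
      T j (lookup e j) r t *ℂ Mℂ.∏ᴹ (λ i → T (ι (suc i)) (lookup e′ (ι (suc i)))) t s
        ≈⟨ C.*-congˡ (∏ᴹ-cong (λ i r s → C.reflexive
             (cong (λ k → T (ι (suc i)) k r s) (e′ᵢ (ι≢j i)))) t s) ⟩
      T j (lookup e j) r t *ℂ Mℂ.∏ᴹ (λ i → T (ι (suc i)) (lookup e (ι (suc i)))) t s ∎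

  coeff-output : ∀ u v e → coeff (ROABP.output (program u v)) e C.≈
                 Mℂ.bilinear u (λ r s → coeff (Mₚ.∏ᴹ factor r s) e) v
  coeff-output u v e = C.trans
    (coeff-sum (λ r → Pₙ.sum λ s → (constₚ (u r) *ₚ Mₚ.∏ᴹ factor r s) *ₚ constₚ (v s)) e)
    (sum-cong-≋ λ r → C.trans
      (coeff-sum (λ s → (constₚ (u r) *ₚ Mₚ.∏ᴹ factor r s) *ₚ constₚ (v s)) e)
      (sum-cong-≋ λ s → C.trans (coeff-*ₚ-const (constₚ (u r) *ₚ Mₚ.∏ᴹ factor r s) (v s) e)
        (C.*-congʳ (coeff-const-*ₚ (u r) (Mₚ.∏ᴹ factor r s) e))))

  coeff-output-excessive : ∀ u v e j → d < lookup e j →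
                           coeff (ROABP.output (program u v)) e C.≈ 0ℂ
  coeff-output-excessive u v e j d<eⱼ = C.trans (coeff-output u v e)
    (bilinear-zero u (λ r s → coeff (Mₚ.∏ᴹ factor r s) e) v
      (coeff-∏ᴹ-excessive id id j e (inj₁ d<eⱼ)))

  coeff-output-≤ : ∀ u v e → (∀ j → lookup e j ≤ d) → coeff (ROABP.output (program u v)) e C.≈
                   Mℂ.bilinear u (Mℂ.∏ᴹ λ j → T j (lookup e j)) v
  coeff-output-≤ u v e e≤d = C.trans (coeff-output u v e)
    (bilinear-cong u (λ r s → coeff (Mₚ.∏ᴹ factor r s) e) (Mℂ.∏ᴹ λ j → T j (lookup e j)) v
      (coeff-∏ᴹ id id e e≤d λ j ι≢j → contradiction refl (ι≢j j)))

  -- The bilinear identity is available at every e, but describes the output only where all e_j ≤ d;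
  -- beyond that, both coefficients vanish separately.
  output-correct : ∀ f u v → IndividualDegree≤ d f →
    (∀ e → Mℂ.bilinear u (Mℂ.∏ᴹ λ j → T j (lookup e j)) v C.≈ coeff f e) →
    f ≈ₚ ROABP.output (program u v)
  output-correct f u v deg correct e = byCases (Fin.any? λ j → d ℕ.<? lookup e j)
    where
    byCases : Dec (∃[ j ] d < lookup e j) → coeff f e C.≈ coeff (ROABP.output (program u v)) e
    byCases (yes (j , d<eⱼ)) = C.trans (deg e j d<eⱼ) (C.sym (coeff-output-excessive u v e j d<eⱼ))
    byCases (no  d≮e)        = C.trans (C.sym (correct e))
      (C.sym (coeff-output-≤ u v e λ j → ℕ.≮⇒≥ λ d<eⱼ → d≮e (j , d<eⱼ)))

-- The program built from a basis of the span of derivatives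

module _ {n r : ℕ} (f : Poly n) (b : Vector (Poly n) r)
         (isBasis : IsBasis (Span λ e → ∂^ e f) b) where
  open IsBasis isBasis

  coordinates-∂^ : ∀ a s → ∃[ c ] (∂^ a (b s) ≈ₚ linComb c b)
  coordinates-∂^ a s = spanning (∂^ a (b s)) (∂^-closed-Span f a (inside s))

  coefficientMatrix : Fin n → ℕ → Matrix ℂ r
  coefficientMatrix j k s t = k !⁻¹ *ℂ proj₁ (coordinates-∂^ (single j k) s) t

  acts-coefficientMatrix : ∀ j k → Acts b (coefficientMatrix j k) (k !⁻¹) (single j k)
  acts-coefficientMatrix j k s e = let c , ∂b≈ = coordinates-∂^ (single j k) s in begin
    sum (λ t → (k !⁻¹ *ℂ c t) *ℂ jet (b t) e)
      ≈⟨ sum-cong-≋ (λ t → C.*-assoc (k !⁻¹) (c t) (jet (b t) e)) ⟩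
    sum (λ t → k !⁻¹ *ℂ (c t *ℂ jet (b t) e))
      ≈⟨ *-distribˡ-sum (k !⁻¹) (λ t → c t *ℂ jet (b t) e) ⟨
    k !⁻¹ *ℂ sum (λ t → c t *ℂ jet (b t) e)
      ≈⟨ C.*-congˡ (jet-linComb c b e) ⟨
    k !⁻¹ *ℂ jet (linComb c b) e
      ≈⟨ C.*-congˡ (jet-cong ∂b≈ e) ⟨
    k !⁻¹ *ℂ jet (∂^ (single j k) (b s)) e
      ≈⟨ C.*-congˡ (jet-∂^ (single j k) (b s) e) ⟩
    k !⁻¹ *ℂ jet (b s) (single j k ⊕ e) ∎
    where open ≈-Reasoning

  -- Both products act as the same multiple, 1 / (k! k′!), of the same derivative.
  coefficientMatrix-comm : ∀ j k j′ k′ →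
    coefficientMatrix j k Mℂ.⊗ coefficientMatrix j′ k′ Mℂ.≋
    coefficientMatrix j′ k′ Mℂ.⊗ coefficientMatrix j k
  coefficientMatrix-comm j k j′ k′ = acts-unique b independent
    (acts-⊗ b (acts-coefficientMatrix j k) (acts-coefficientMatrix j′ k′))
    (acts-⊗ b (acts-coefficientMatrix j′ k′) (acts-coefficientMatrix j k))
    (C.*-comm (k !⁻¹) (k′ !⁻¹)) (⊕-comm (single j k) (single j′ k′))

  coordinates : Vector ℂ r
  coordinates = proj₁ (spanning f (self∈Span-∂^ f))

  -- The factor `∏ _! 𝟘` is a product of ones, so this is b_s(0), written as a jet so that `Acts`
  -- applies at the exponent 𝟘.
  constantTerms : Vector ℂ r
  constantTerms s = jet (b s) 𝟘

  -- The product of the matrices acts as ∂ᵉ / e!. Evaluating at 0 and combining with the coordinates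
  -- of f leaves (∂ᵉf)(0) / e!, for every e and without a degree bound.
  bilinear-∏ᴹ : ∀ e →
    Mℂ.bilinear coordinates (Mℂ.∏ᴹ λ j → coefficientMatrix j (lookup e j)) constantTerms C.≈
    coeff f e
  bilinear-∏ᴹ e = begin
    sum (λ s → sum λ t → u s *ℂ X s t *ℂ jet (b t) 𝟘)
      ≈⟨ sum-cong-≋ row ⟩
    sum (λ s → κ *ℂ (u s *ℂ jet (b s) e))
      ≈⟨ *-distribˡ-sum κ (λ s → u s *ℂ jet (b s) e) ⟨
    κ *ℂ sum (λ s → u s *ℂ jet (b s) e)
      ≈⟨ C.*-congˡ (jet-linComb u b e) ⟨
    κ *ℂ jet (linComb u b) e
      ≈⟨ C.*-congˡ (jet-cong (proj₂ (spanning f (self∈Span-∂^ f))) e) ⟨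
    κ *ℂ jet f e
      ≈⟨ coeff-jet f e ⟨
    coeff f e ∎
    where
    open ≈-Reasoning
    u = coordinates
    X = Mℂ.∏ᴹ λ j → coefficientMatrix j (lookup e j)
    κ = ∏ _!⁻¹ e
    actsX : ∀ s → sum (λ t → X s t *ℂ jet (b t) 𝟘) C.≈ κ *ℂ jet (b s) e
    actsX s = C.trans
      (acts-∏ᴹ b (λ j → coefficientMatrix j (lookup e j)) (_!⁻¹ ∘ lookup e)
        (λ j → single j (lookup e j)) (λ j → acts-coefficientMatrix j (lookup e j)) s 𝟘)
      (C.reflexive (cong₂ (λ c a → c *ℂ jet (b s) a) (∏-lookup _!⁻¹ e)
        (trans (⊕-identityʳ _) (⨁-single e))))
    row : ∀ s → sum (λ t → u s *ℂ X s t *ℂ jet (b t) 𝟘) C.≈ κ *ℂ (u s *ℂ jet (b s) e)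
    row s = begin
      sum (λ t → u s *ℂ X s t *ℂ jet (b t) 𝟘)
        ≈⟨ sum-cong-≋ (λ t → C.*-assoc (u s) (X s t) (jet (b t) 𝟘)) ⟩
      sum (λ t → u s *ℂ (X s t *ℂ jet (b t) 𝟘))
        ≈⟨ *-distribˡ-sum (u s) (λ t → X s t *ℂ jet (b t) 𝟘) ⟨
      u s *ℂ sum (λ t → X s t *ℂ jet (b t) 𝟘)
        ≈⟨ C.*-congˡ (actsX s) ⟩
      u s *ℂ (κ *ℂ jet (b s) e)
        ≈⟨ x∙yz≈y∙xz (u s) κ _ ⟩
      κ *ℂ (u s *ℂ jet (b s) e) ∎

  computable : ∀ d → IndividualDegree≤ d f → CommROABPComputable d f r
  computable d deg = program d coefficientMatrix coordinates constantTerms ,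
    (λ j k j′ k′ → coefficientMatrix-comm j (toℕ k) j′ (toℕ k′)) ,
    output-correct d coefficientMatrix f coordinates constantTerms deg bilinear-∏ᴹ

theorem1p4 : ∀ (n : ℕ) (f : Poly n) → Homogeneous f →
    ∀ (d : ℕ) → IndividualDegree≤ d f →
    ∀ (r : ℕ) → HasDPD f r →
    (∃[ w ] CommROABPComputable d f w) ×
    (∀ (w : ℕ) → HasCommRO d f w → w ≤ r)
theorem1p4 n f _ d deg r (b , isBasis) =
  -- The width r itself is attained, which shows that the set of widths is inhabited and, by
  -- minimality, bounds its least element.
  (r , computable f b isBasis d deg) ,
  (λ w (_ , least) → least r (computable f b isBasis d deg))
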